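{- Parameterized by $k+(n-s_{\min})+(m-o_{\min})$, \textsc{Set Cover with Demands} is solvable in $\mathcal{O}\Big((n\cdot m)\cdot \big((n-s_{\min})\cdot(m-o_{\min})\big)^k\Big)$ time.
   Context: Write $[n]=\{1,\dots,n\}$. An instance of \textsc{Set Cover with Demands} consists of a universe $U=[n]$, a list of demands $d_1,\dots,d_n\in[m]$, a family of subsets $\mathcal{F}=\{F_1,\dots,F_m\}$ over $U$, and an integer $k\in\mathbb{N}$. The question is whether there exists a subset $\mathcal{S}\subseteq\mathcal{F}$ with $|\mathcal{S}|=k$ such that each element $i\in U$ is included in at least $d_i$ sets from $\mathcal{S}$. For $i\in U$ let $\mathcal{F}(i)$ denote the subfamily of sets of $\mathcal{F}$ containing $i$. Then $s_{\min}=\min_{j\in[m]}|F_j|$ is the minimum size of a set from the family and $o_{\min}=\min_{i\in[n]}|\mathcal{F}(i)|$ is the minimum number of occurrences of an element in sets from the family.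
   Formalization: The base (n−s_min)(m−o_min) of the power is replaced by its maximum with 1, because when every F_j equals U and k ≥ 1 the stated bound is 0 and no algorithm runs in zero time. -}

module Defs where

open import Data.Bool using (if_then_else_)
open import Data.Fin using (Fin; zero; suc; remQuot)
open import Data.Fin.Subset using (Subset; ∣_∣; _∩_)
open import Data.Nat
  using (ℕ; zero; suc; _+_; _*_; _∸_; _⊓_; _≤_; _≡ᵇ_; NonZero)
open import Data.Product using (∃; ∃-syntax; Σ-syntax; _×_; _,_)
open import Data.Sum using (_⊎_)
open import Data.Vec using (Vec; lookup; tabulate; foldr₁)
open import Relation.Binary.PropositionalEquality using (_≡_; _≢_)
open import Relation.Nullary using (¬_)

------------------------------------------------------------------------
-- Random access machine

-- Structured programs for a random access machine with uniform (unit)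
-- cost.  A program mentions finitely many registers and finitely many
-- one-dimensional arrays; laying the arrays out interleaved in a single
-- memory would change running times by a constant factor only.
-- Addition and truncated subtraction are the only arithmetic operations:
-- with unit-cost multiplication, t steps could build numbers of 2^t bits.

Reg Arr : Set
Reg = ℕ
Arr = ℕ

infixl 6 _⊕_ _⊖_
infix  8 _[_]

data Expr : Set where
  lit     : ℕ → Expr
  reg     : Reg → Expr
  _[_]    : Arr → Expr → Expr
  _⊕_ _⊖_ : Expr → Expr → Expr

infixr 3 _⨾_
infix  4 _≔_ _[_]≔_

data Cmd : Set where
  skip    : Cmd
  _≔_     : Reg → Expr → Cmd
  _[_]≔_  : Arr → Expr → Expr → Cmd
  _⨾_     : Cmd → Cmd → Cmd
  if      : Expr → Cmd → Cmd → Cmd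
  while   : Expr → Cmd → Cmd

record State : Set where
  constructor state
  field
    regs : Reg → ℕ
    arrs : Arr → ℕ → ℕ

open State public

_[_↦_] : ∀ {A : Set} → (ℕ → A) → ℕ → A → (ℕ → A)
(f [ x ↦ v ]) y = if x ≡ᵇ y then v else f y

setReg : Reg → ℕ → State → State
setReg x v (state r a) = state (r [ x ↦ v ]) a

setArr : Arr → ℕ → ℕ → State → State
setArr b i v (state r a) = state r (a [ b ↦ a b [ i ↦ v ] ])

⟦_⟧ : Expr → State → ℕ
⟦ lit c   ⟧ σ = c
⟦ reg x   ⟧ σ = regs σ x
⟦ b [ e ] ⟧ σ = arrs σ b (⟦ e ⟧ σ)
⟦ e ⊕ e′  ⟧ σ = ⟦ e ⟧ σ + ⟦ e′ ⟧ σ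
⟦ e ⊖ e′  ⟧ σ = ⟦ e ⟧ σ ∸ ⟦ e′ ⟧ σ

cost : Expr → ℕ
cost (lit c)   = 1
cost (reg x)   = 1
cost (b [ e ]) = 1 + cost e
cost (e ⊕ e′)  = 1 + (cost e + cost e′)
cost (e ⊖ e′)  = 1 + (cost e + cost e′)

-- c , σ ⇓ σ′ ⟨ t ⟩: started in σ, the command c halts in σ′ after exactly
-- t steps.  A guard counts as true when its value is nonzero.

infix 2 _,_⇓_⟨_⟩

data _,_⇓_⟨_⟩ : Cmd → State → State → ℕ → Set where
  ⇓skip : ∀ {σ} → skip , σ ⇓ σ ⟨ 1 ⟩
  ⇓reg : ∀ {x e σ} →
    (x ≔ e) , σ ⇓ setReg x (⟦ e ⟧ σ) σ ⟨ 1 + cost e ⟩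
  ⇓arr : ∀ {b e e′ σ} →
    (b [ e ]≔ e′) , σ ⇓ setArr b (⟦ e ⟧ σ) (⟦ e′ ⟧ σ) σ
      ⟨ 1 + (cost e + cost e′) ⟩
  ⇓seq : ∀ {c c′ σ σ′ σ″ t t′} →
    c , σ ⇓ σ′ ⟨ t ⟩ → c′ , σ′ ⇓ σ″ ⟨ t′ ⟩ →
    (c ⨾ c′) , σ ⇓ σ″ ⟨ t + t′ ⟩
  ⇓then : ∀ {e c c′ σ σ′ t} → ⟦ e ⟧ σ ≢ 0 →
    c , σ ⇓ σ′ ⟨ t ⟩ → if e c c′ , σ ⇓ σ′ ⟨ 1 + (cost e + t) ⟩
  ⇓else : ∀ {e c c′ σ σ′ t} → ⟦ e ⟧ σ ≡ 0 →
    c′ , σ ⇓ σ′ ⟨ t ⟩ → if e c c′ , σ ⇓ σ′ ⟨ 1 + (cost e + t) ⟩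
  ⇓stop : ∀ {e c σ} → ⟦ e ⟧ σ ≡ 0 →
    while e c , σ ⇓ σ ⟨ 1 + cost e ⟩
  ⇓loop : ∀ {e c σ σ′ σ″ t t′} → ⟦ e ⟧ σ ≢ 0 →
    c , σ ⇓ σ′ ⟨ t ⟩ → while e c , σ′ ⇓ σ″ ⟨ t′ ⟩ →
    while e c , σ ⇓ σ″ ⟨ 1 + (cost e + (t + t′)) ⟩

------------------------------------------------------------------------
-- Parameterized problems and running time

record ParameterizedProblem : Set₁ where
  field
    Instance  : Set
    Yes       : Instance → Set
    parameter : Instance → ℕ
    encode    : Instance → State

-- The answer is left in register 0: 1 for yes, 0 for no.
Answers : Set → State → Set
Answers P σ = (P × regs σ 0 ≡ 1) ⊎ (¬ P × regs σ 0 ≡ 0)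

-- "Solvable in O(g) time": one program and one constant for all instances.
-- The parameter is not an argument of g: g is a function of the instance,
-- which determines the parameter.
SolvableInTimeO : (P : ParameterizedProblem) →
  (ParameterizedProblem.Instance P → ℕ) → Set
SolvableInTimeO P g =
  Σ[ c ∈ Cmd ] Σ[ C ∈ ℕ ] ∀ (I : Instance) →
    ∃[ σ ] ∃[ t ]
      (c , encode I ⇓ σ ⟨ t ⟩) × Answers (Yes I) σ × t ≤ C * g I
  where open ParameterizedProblem P

------------------------------------------------------------------------
-- Set Cover with Demands

minimum : ∀ {p} .{{_ : NonZero p}} → (Fin p → ℕ) → ℕ
minimum {suc p} f = foldr₁ _⊓_ (tabulate f)

-- The elements are Fin n and the family is indexed by Fin m.  Nonemptiness
-- of both index sets is what makes s-min and o-min meaningful.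
record SetCoverInstance : Set where
  field
    n m       : ℕ
    .{{n≢0}}  : NonZero n
    .{{m≢0}}  : NonZero m
    demand    : Fin n → ℕ
    demand∈[m] : ∀ i → 1 ≤ demand i × demand i ≤ m
    F         : Fin m → Subset n
    k         : ℕ

  occurrences : Fin n → Subset m
  occurrences i = tabulate λ j → lookup (F j) i

  s-min : ℕ
  s-min = minimum λ j → ∣ F j ∣

  o-min : ℕ
  o-min = minimum λ i → ∣ occurrences i ∣

  Coverable : Set
  Coverable = ∃[ S ] (∣ S ∣ ≡ k × ∀ i → demand i ≤ ∣ S ∩ occurrences i ∣)

-- An array starting with the given values and zero from then on.
layout : ∀ {p} → (Fin p → ℕ) → ℕ → ℕ
layout {zero}  f x       = 0
layout {suc p} f zero    = f zero
layout {suc p} f (suc x) = layout (λ i → f (suc i)) x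

-- Registers 0, 1, 2 hold n, m, k.  Array 0 holds the demands and array 1
-- the incidence matrix in row-major order: the entry for set j and
-- element i is at address n * j + i.  Everything else is zero.
encodeSetCover : SetCoverInstance → State
encodeSetCover I = state registers arrays
  where
  open SetCoverInstance I

  incidence : Fin (m * n) → ℕ
  incidence x =
    let j , i = remQuot n x in if lookup (F j) i then 1 else 0

  registers : Reg → ℕ
  registers 0 = n
  registers 1 = m
  registers 2 = k
  registers _ = 0

  arrays : Arr → ℕ → ℕ
  arrays 0 = layout demand
  arrays 1 = layout incidence
  arrays _ = λ _ → 0

SetCoverWithDemands : ParameterizedProblem
SetCoverWithDemands = record
  { Instance  = SetCoverInstance
  ; Yes       = SetCoverInstance.Coverable
  ; parameter = λ I → let open SetCoverInstance I in
                  k + (n ∸ s-min) + (m ∸ o-min)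
  ; encode    = encodeSetCover
  }

{-# OPTIONS --safe #-}
module Submission where

-- Let the complement of a set be the elements it misses.  Choosing S with
-- |S| = k is packing k complements so that each element i lies in at most
-- k − d i of them; with a = n − s-min and b = m − o-min, a complement has at
-- most a elements and an element lies in at most b complements.  Call a set
-- valid if it can be added to the current partial packing.  If j is valid and
-- a solution picks no set whose complement meets that of j, then any of its
-- further picks can be exchanged for j.  So it suffices to branch on the sets
-- in the closed neighbourhood of j, of which there are at most max(1, a b).
-- If a b ≥ 2, the search tree has O((a b)^k) nodes, each handled in O(n m)
-- steps.  A tree of constant branching 1 could still have k levels, so the case
-- of pairwise disjoint complements is treated apart: there the answer only
-- depends on the number of valid sets.

open import Defs
open import Data.Bool using (Bool; true; false; if_then_else_; _∨_; _∧_; not; T)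
open import Data.Fin using (Fin; zero; suc; toℕ; fromℕ<; combine)
open import Data.Fin.Properties using (toℕ<n; toℕ-fromℕ<; toℕ-combine; remQuot-combine)
open import Data.Fin.Subset using (Subset; ∣_∣; _∩_; ∁)
open import Data.Fin.Subset.Properties using (∣∁p∣≡n∸∣p∣)
open import Data.List using (List; []; _∷_; length; map)
open import Data.List.Relation.Unary.All using (All; []; _∷_) renaming (map to All-map)
open import Data.List.Relation.Unary.All.Properties using (¬Any⇒All¬; map⁺)
open import Data.List.Relation.Unary.Any using (Any; here; there; any?)
open import Data.Nat
open import Data.Nat.Properties
open import Data.Nat.Tactic.RingSolver using (solve-∀)
open import Data.Product using (Σ-syntax; ∃-syntax; _×_; _,_; proj₁; proj₂)
open import Data.Sum using (_⊎_; inj₁; inj₂)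
open import Data.Vec using ([]; _∷_; lookup; tabulate)
open import Data.Vec.Properties using (lookup-map; lookup-zipWith; lookup∘tabulate)
open import Function using (_∘_; const)
open import Relation.Binary.PropositionalEquality hiding ([_])
open import Relation.Nullary
open import Relation.Nullary.Decidable using (True; toWitness; decidable-stable)
open import Algebra.Properties.CommutativeSemigroup +-commutativeSemigroup
  using (interchange; x∙yz≈y∙xz; xy∙z≈y∙xz)

-- Finite sums

-- The program computes neither a nor b. It only asks whether some element lies in two complements:
-- such an element forces b to be at least 2 and a to be at least 1, which secures the geometric
-- growth of the tree without a test on a b itself. The base of the power is max(1, a b) because a b
-- may be 0, and a literal power would then allow no time at all for positive k.
--
-- A node costs O(n m) because each of the m candidates is tested by sums of length n; the
-- neighbourhood of the pivot is never stored.
--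
-- The machine model shapes the encodings. Without recursion, the search becomes a single loop with
-- an explicit stack. Without multiplication, products of bits and addresses must come from addition
-- and truncated subtraction. Conditions are therefore expressed as sums of natural numbers that
-- vanish exactly when the condition holds.

Σ< : ℕ → (ℕ → ℕ) → ℕ
Σ< zero    f = 0
Σ< (suc n) f = Σ< n f + f n

Σ<-mono : ∀ n {f g} → (∀ i → i < n → f i ≤ g i) → Σ< n f ≤ Σ< n g
Σ<-mono zero    h = z≤n
Σ<-mono (suc n) h = +-mono-≤ (Σ<-mono n λ i i<n → h i (m<n⇒m<1+n i<n)) (h n ≤-refl)

Σ<-cong : ∀ n {f g} → (∀ i → i < n → f i ≡ g i) → Σ< n f ≡ Σ< n g
Σ<-cong n h = ≤-antisym (Σ<-mono n λ i i<n → ≤-reflexive (h i i<n))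
                        (Σ<-mono n λ i i<n → ≤-reflexive (sym (h i i<n)))

Σ<-+ : ∀ n f g → Σ< n (λ i → f i + g i) ≡ Σ< n f + Σ< n g
Σ<-+ zero    f g = refl
Σ<-+ (suc n) f g = trans (cong (_+ (f n + g n)) (Σ<-+ n f g))
                         (interchange (Σ< n f) (Σ< n g) (f n) (g n))

Σ<-*ˡ : ∀ n c f → Σ< n (λ i → c * f i) ≡ c * Σ< n f
Σ<-*ˡ zero    c f = sym (*-zeroʳ c)
Σ<-*ˡ (suc n) c f = trans (cong (_+ c * f n) (Σ<-*ˡ n c f)) (sym (*-distribˡ-+ c (Σ< n f) (f n)))

Σ<-*ʳ : ∀ n c f → Σ< n (λ i → f i * c) ≡ Σ< n f * c
Σ<-*ʳ n c f = trans (Σ<-cong n λ i _ → *-comm (f i) c) (trans (Σ<-*ˡ n c f) (*-comm c (Σ< n f)))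

Σ<-0 : ∀ n → Σ< n (λ _ → 0) ≡ 0
Σ<-0 zero    = refl
Σ<-0 (suc n) = trans (+-identityʳ _) (Σ<-0 n)

Σ<-swap : ∀ n m (f : ℕ → ℕ → ℕ) → Σ< n (λ i → Σ< m (f i)) ≡ Σ< m (λ j → Σ< n (λ i → f i j))
Σ<-swap zero    m f = sym (Σ<-0 m)
Σ<-swap (suc n) m f = trans (cong (_+ Σ< m (f n)) (Σ<-swap n m f)) (sym (Σ<-+ m _ (f n)))

Σ<-suc : ∀ n f → Σ< (suc n) f ≡ f 0 + Σ< n (f ∘ suc)
Σ<-suc zero    f = +-comm 0 (f 0)
Σ<-suc (suc n) f = trans (cong (_+ f (suc n)) (Σ<-suc n f)) (+-assoc (f 0) _ _)

term≤Σ< : ∀ n f {i} → i < n → f i ≤ Σ< n f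
term≤Σ< (suc n) f {i} i<1+n with i ≟ n
... | yes refl = m≤n+m (f i) (Σ< n f)
... | no i≢n   = ≤-trans (term≤Σ< n f (≤∧≢⇒< (≤-pred i<1+n) i≢n)) (m≤m+n _ _)

Σ<≡0 : ∀ n {f} → (∀ i → i < n → f i ≡ 0) → Σ< n f ≡ 0
Σ<≡0 n h = trans (Σ<-cong n h) (Σ<-0 n)

Σ<≢0⇒term : ∀ n f → Σ< n f ≢ 0 → ∃[ i ] i < n × f i ≢ 0
Σ<≢0⇒term zero    f h = contradiction refl h
Σ<≢0⇒term (suc n) f h with f n ≟ 0
... | no fn≢0  = n , ≤-refl , fn≢0
... | yes fn≡0 with i , i<n , fi≢0 ← Σ<≢0⇒term n f (λ e → h (cong₂ _+_ e fn≡0))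
               = i , m<n⇒m<1+n i<n , fi≢0

δ : ℕ → ℕ → ℕ
δ j p = if p ≡ᵇ j then 1 else 0

≡ᵇ-refl : ∀ p → (p ≡ᵇ p) ≡ true
≡ᵇ-refl zero = refl
≡ᵇ-refl (suc p) = ≡ᵇ-refl p

≢⇒≡ᵇ : ∀ {p j} → p ≢ j → (p ≡ᵇ j) ≡ false
≢⇒≡ᵇ {p} {j} p≢j with p ≡ᵇ j in eq
... | false = refl
... | true  = contradiction (≡ᵇ⇒≡ p j (subst T (sym eq) _)) p≢j

δ-refl : ∀ j → δ j j ≡ 1
δ-refl j rewrite ≡ᵇ-refl j = refl

δ-≢ : ∀ {j p} → p ≢ j → δ j p ≡ 0
δ-≢ p≢j rewrite ≢⇒≡ᵇ p≢j = refl

Σ<-δ : ∀ m p (g : ℕ → ℕ) → p < m → Σ< m (λ j → δ j p * g j) ≡ g p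
Σ<-δ (suc m) p g p<1+m with p ≟ m
... | yes refl rewrite δ-refl p =
  trans (cong (_+ (g p + 0)) (Σ<≡0 p λ j j<p → cong (_* g j) (δ-≢ λ e → <-irrefl (sym e) j<p)))
        (+-identityʳ (g p))
... | no p≢m rewrite δ-≢ p≢m =
  trans (+-identityʳ _) (Σ<-δ m p g (≤∧≢⇒< (≤-pred p<1+m) p≢m))

-- A program logic with time bounds

-- A Boolean footprint rather than a predicate: on a concrete program it evaluates, so most frame
-- conditions are closed by `refl`.
writesReg : Cmd → Reg → Bool
writesReg skip          y = false
writesReg (x ≔ e)       y = x ≡ᵇ y
writesReg (b [ e ]≔ e′) y = false
writesReg (c ⨾ c′)      y = writesReg c y ∨ writesReg c′ y
writesReg (if e c c′)   y = writesReg c y ∨ writesReg c′ y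
writesReg (while e c)   y = writesReg c y

writesArr : Cmd → Arr → Bool
writesArr skip          y = false
writesArr (x ≔ e)       y = false
writesArr (b [ e ]≔ e′) y = b ≡ᵇ y
writesArr (c ⨾ c′)      y = writesArr c y ∨ writesArr c′ y
writesArr (if e c c′)   y = writesArr c y ∨ writesArr c′ y
writesArr (while e c)   y = writesArr c y

∨-falseˡ : ∀ a {b} → a ∨ b ≡ false → a ≡ false
∨-falseˡ false _ = refl

∨-falseʳ : ∀ a {b} → a ∨ b ≡ false → b ≡ false
∨-falseʳ false h = h

record Same (c : Cmd) (σ τ : State) : Set where
  constructor same
  field
    regs≡ : ∀ y → writesReg c y ≡ false → regs τ y ≡ regs σ y
    arrs≡ : ∀ b → writesArr c b ≡ false → arrs τ b ≡ arrs σ b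

open Same public

same-refl : ∀ {c σ} → Same c σ σ
same-refl = same (λ _ _ → refl) (λ _ _ → refl)

same-trans : ∀ {c σ τ υ} → Same c σ τ → Same c τ υ → Same c σ υ
same-trans s s′ = same (λ y h → trans (regs≡ s′ y h) (regs≡ s y h))
                       (λ b h → trans (arrs≡ s′ b h) (arrs≡ s b h))

same-setReg : ∀ {c σ} x v → (∀ y → writesReg c y ≡ false → (x ≡ᵇ y) ≡ false) →
  Same c σ (setReg x v σ)
same-setReg {σ = σ} x v h =
  same (λ y e → cong (λ z → if z then v else regs σ y) (h y e)) (λ _ _ → refl)

same-⊆ : ∀ {c c′ σ τ} →
  (∀ y → writesReg c′ y ≡ false → writesReg c y ≡ false) →
  (∀ b → writesArr c′ b ≡ false → writesArr c b ≡ false) →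
  Same c σ τ → Same c′ σ τ
same-⊆ r a s = same (λ y h → regs≡ s y (r y h)) (λ b h → arrs≡ s b (a b h))

same-ˡ : ∀ {c c′ σ τ} → Same c σ τ → Same (c ⨾ c′) σ τ
same-ˡ {c} = same-⊆ (λ y → ∨-falseˡ (writesReg c y)) (λ b → ∨-falseˡ (writesArr c b))

same-ʳ : ∀ {c c′ σ τ} → Same c′ σ τ → Same (c ⨾ c′) σ τ
same-ʳ {c} = same-⊆ (λ y → ∨-falseʳ (writesReg c y)) (λ b → ∨-falseʳ (writesArr c b))

frame : ∀ {c σ τ t} → c , σ ⇓ τ ⟨ t ⟩ → Same c σ τ
frame ⇓skip = same-refl
frame (⇓reg {x} {e} {σ}) = same-setReg x _ λ _ h → h
frame (⇓arr {b} {e} {e′} {σ}) =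
  same (λ _ _ → refl)
       (λ y h → cong (if_then arrs σ b [ ⟦ e ⟧ σ ↦ ⟦ e′ ⟧ σ ] else arrs σ y) h)
frame (⇓seq {c} {c′} p q) = same-trans (same-ˡ {c} {c′} (frame p)) (same-ʳ {c} {c′} (frame q))
frame (⇓then {_} {c} {c′} _ p) = same-⊆ (λ y → ∨-falseˡ (writesReg c y)) (λ b → ∨-falseˡ (writesArr c b)) (frame p)
frame (⇓else {_} {c} {c′} _ p) = same-⊆ (λ y → ∨-falseʳ (writesReg c y)) (λ b → ∨-falseʳ (writesArr c b)) (frame p)
frame (⇓stop _) = same-refl
frame (⇓loop _ p q) = same-trans (same-⊆ (λ _ h → h) (λ _ h → h) (frame p)) (frame q)

-- Keeping only an upper bound on the time lets the costs of composed programs be added without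
-- tracking exact step counts.
record Run (c : Cmd) (σ : State) (T : ℕ) (Q : State → Set) : Set where
  constructor mkRun
  field
    {end}  : State
    {time} : ℕ
    exec   : c , σ ⇓ end ⟨ time ⟩
    bound  : time ≤ T
    post   : Q end

open Run public

private variable
  c c′ : Cmd
  e e′ : Expr
  σ τ : State
  S S′ : ℕ
  Q R : State → Set

weaken : S ≤ S′ → Run c σ S Q → Run c σ S′ Q
weaken S≤S′ (mkRun x b q) = mkRun x (≤-trans b S≤S′) q

consequence : (∀ {τ} → Same c σ τ → Q τ → R τ) → Run c σ S Q → Run c σ S R
consequence h (mkRun x b q) = mkRun x b (h (frame x) q)

infixr 2 _then_
_then_ : Run c σ S Q → (∀ {τ} → Same c σ τ → Q τ → Run c′ τ S′ R) → Run (c ⨾ c′) σ (S + S′) R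
mkRun x b q then f with mkRun x′ b′ r ← f (frame x) q = mkRun (⇓seq x x′) (+-mono-≤ b b′) r

skip-rule : Q σ → Run skip σ 1 Q
skip-rule = mkRun ⇓skip ≤-refl

reg-rule : ∀ {x} → Q (setReg x (⟦ e ⟧ σ) σ) → Run (x ≔ e) σ (1 + cost e) Q
reg-rule = mkRun ⇓reg ≤-refl

arr-rule : ∀ {b} → Q (setArr b (⟦ e ⟧ σ) (⟦ e′ ⟧ σ) σ) → Run (b [ e ]≔ e′) σ (1 + (cost e + cost e′)) Q
arr-rule = mkRun ⇓arr ≤-refl

reg-seq : ∀ {x} → Run c (setReg x (⟦ e ⟧ σ) σ) S Q → Run (x ≔ e ⨾ c) σ (1 + cost e + S) Q
reg-seq (mkRun x b q) = mkRun (⇓seq ⇓reg x) (+-monoʳ-≤ _ b) q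

arr-seq : ∀ {b} → Run c (setArr b (⟦ e ⟧ σ) (⟦ e′ ⟧ σ) σ) S Q →
  Run (b [ e ]≔ e′ ⨾ c) σ (1 + (cost e + cost e′) + S) Q
arr-seq (mkRun x b q) = mkRun (⇓seq ⇓arr x) (+-monoʳ-≤ _ b) q

then-rule : ⟦ e ⟧ σ ≢ 0 → Run c σ S Q → Run (if e c c′) σ (1 + (cost e + S)) Q
then-rule h (mkRun x b q) = mkRun (⇓then h x) (s≤s (+-monoʳ-≤ _ b)) q

else-rule : ⟦ e ⟧ σ ≡ 0 → Run c′ σ S Q → Run (if e c c′) σ (1 + (cost e + S)) Q
else-rule h (mkRun x b q) = mkRun (⇓else h x) (s≤s (+-monoʳ-≤ _ b)) q

-- Counting loops

forBody : Reg → Cmd → Cmd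
forBody x c = c ⨾ x ≔ reg x ⊕ lit 1

for : Reg → Reg → Cmd → Cmd
for x b c = x ≔ lit 0 ⨾ while (reg b ⊖ reg x) (forBody x c)

module _ {x b : Reg} {c : Cmd} {σ : State} {N S : ℕ} (Inv : ℕ → State → Set) (b≡N : regs σ b ≡ N)
         (x∉c : writesReg c x ≡ false) (b∉c : writesReg c b ≡ false) (x≢b : (x ≡ᵇ b) ≡ false)
         (step : ∀ {i τ} → i < N → regs τ x ≡ i → Same (for x b c) σ τ → Inv i τ →
                 Run c τ S (λ υ → Inv (suc i) (setReg x (suc i) υ)))
  where

  private
    bound-kept : ∀ {τ} → Same (for x b c) σ τ → regs τ b ≡ N
    bound-kept s = trans (regs≡ s b (cong₂ _∨_ x≢b (cong₂ _∨_ b∉c x≢b))) b≡N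

    next : ∀ {i τ υ} → regs τ x ≡ i → Same c τ υ →
           (Q : State → Set) → Q (setReg x (suc i) υ) → Q (setReg x (regs υ x + 1) υ)
    next {i} {τ} {υ} x≡i s Q = subst (λ v → Q (setReg x v υ))
      (trans (cong suc (trans (sym x≡i) (sym (regs≡ s x x∉c)))) (+-comm 1 (regs υ x)))

    loop : ∀ r {i τ} → i + r ≡ N → regs τ x ≡ i → Same (for x b c) σ τ → Inv i τ →
      Run (while (reg b ⊖ reg x) (forBody x c)) τ (4 + r * (8 + S)) (Inv N)
    loop zero {i} {τ} i+0≡N x≡i s inv =
      mkRun (⇓stop (m≤n⇒m∸n≡0 (≤-reflexive (trans (bound-kept s) (trans (sym i≡N) (sym x≡i))))))
            ≤-refl (subst (λ v → Inv v τ) i≡N inv)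
      where
      i≡N = trans (sym (+-identityʳ i)) i+0≡N
    loop (suc r) {i} {τ} i+1+r≡N x≡i s inv
      with i<N ← subst (i <_) i+1+r≡N (m<m+n i z<s)
      with mkRun {υ} y y≤S inv′ ← step i<N x≡i s inv
      with s′ ← frame y
      with mkRun z z≤ q ← loop r {suc i} {setReg x (regs υ x + 1) υ} (trans (sym (+-suc i r)) i+1+r≡N)
             (next x≡i s′ (λ τ → regs τ x ≡ suc i) (cong (if_then suc i else regs υ x) (≡ᵇ-refl x)))
             (same-trans s (same-trans
               (same-⊆ (λ y h → ∨-falseˡ (writesReg c y) (∨-falseʳ (x ≡ᵇ y) h))
                       (λ b h → ∨-falseˡ (writesArr c b) h) s′)
               (same-setReg x _ λ y h → ∨-falseˡ (x ≡ᵇ y) h)))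
             (next x≡i s′ (Inv (suc i)) inv′)
      = mkRun (⇓loop (λ e → <⇒≱ i<N (subst₂ _≤_ (bound-kept s) x≡i (m∸n≡0⇒m≤n e))) (⇓seq y ⇓reg) z)
              (≤-trans (+-monoʳ-≤ 4 (+-mono-≤ (+-monoˡ-≤ 4 y≤S) z≤))
                       (≤-reflexive (shuffle S (r * (8 + S)))))
              q
      where
      shuffle : ∀ a b → 4 + (a + 4 + (4 + b)) ≡ 4 + (8 + a + b)
      shuffle = solve-∀

  -- Initialisation costs 2, each of the `N + 1` evaluations of the guard 4, and each increment 4.
  -- As `step` establishes the invariant with the index already advanced, nothing remains to be
  -- shown about the increment.
  for-rule : Inv 0 (setReg x 0 σ) → Run (for x b c) σ (6 + N * (8 + S)) (Inv N)
  for-rule inv = reg-seq {x = x} (loop N refl (cong (if_then 0 else regs σ x) (≡ᵇ-refl x))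
    (same-setReg x 0 λ y h → ∨-falseˡ (x ≡ᵇ y) h) inv)

sumLoop : Reg → Expr → Cmd
sumLoop b e = for 4 b (5 ≔ reg 5 ⊕ e)

-- The accumulator keeps its initial value, so `test` and `neighbour` can load the membership or
-- equality term into register 5 before summing.
sum-rule : ∀ {b N} f → regs σ b ≡ N → (4 ≡ᵇ b) ≡ false → (5 ≡ᵇ b) ≡ false →
  (∀ {i τ} → i < N → regs τ 4 ≡ i → Same (sumLoop b e) σ τ → ⟦ e ⟧ τ ≡ f i) →
  Run (sumLoop b e) σ (6 + N * (11 + cost e)) (λ τ → regs τ 5 ≡ regs σ 5 + Σ< N f)
sum-rule {σ} {e} {b} {N} f b≡N 4≢b 5≢b h =
  for-rule (λ i τ → regs τ 5 ≡ regs σ 5 + Σ< i f) b≡N refl 5≢b 4≢b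
    (λ {i} i<N 4≡i s inv → reg-rule {e = reg 5 ⊕ e} (trans (cong₂ _+_ inv (h i<N 4≡i s)) (+-assoc (regs σ 5) (Σ< i f) (f i))))
    (sym (+-identityʳ _))

mapLoop : Reg → Arr → Expr → Cmd
mapLoop bnd a e = for 4 bnd (a [ reg 4 ]≔ e)

[↦]-≡ : ∀ {A : Set} (f : ℕ → A) {x y v} → x ≡ y → (f [ x ↦ v ]) y ≡ v
[↦]-≡ f {x} {v = v} refl = cong (λ z → if z then v else f x) (≡ᵇ-refl x)

[↦]-≢ : ∀ {A : Set} (f : ℕ → A) {x y v} → x ≢ y → (f [ x ↦ v ]) y ≡ f y
[↦]-≢ f {x} {y} {v} x≢y = cong (λ z → if z then v else f y) (≢⇒≡ᵇ x≢y)

-- In-place updates are sound because the invariant also covers the cells not yet reached: cell `i`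
-- still has its original value when it is visited.
map-rule : ∀ {bnd a N} (f : ℕ → ℕ) → regs σ bnd ≡ N → (4 ≡ᵇ bnd) ≡ false →
  (∀ {i τ} → i < N → regs τ 4 ≡ i → Same (mapLoop bnd a e) σ τ → arrs τ a i ≡ arrs σ a i → ⟦ e ⟧ τ ≡ f i) →
  Run (mapLoop bnd a e) σ (6 + N * (10 + cost e)) (λ τ → ∀ {i} → i < N → arrs τ a i ≡ f i)
map-rule {σ} {e} {bnd} {a} {N} f b≡N 4≢b h = consequence (λ _ → proj₁)
  (for-rule Inv b≡N refl refl 4≢b
    (λ {i} {τ} i<N 4≡i s inv → arr-rule {e = reg 4} {e′ = e} (advance τ i<N 4≡i s inv))
    ((λ ()) , λ _ → refl))
  where
  Inv : ℕ → State → Set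
  Inv i τ = (∀ {x} → x < i → arrs τ a x ≡ f x) × (∀ {x} → i ≤ x → arrs τ a x ≡ arrs σ a x)
  advance : ∀ {i} τ → i < N → regs τ 4 ≡ i → Same (mapLoop bnd a e) σ τ → Inv i τ →
    Inv (suc i) (setArr a (regs τ 4) (⟦ e ⟧ τ) τ)
  advance {i} τ i<N refl s (done , todo) rewrite ≡ᵇ-refl a =
    (λ {x} x≤i → done′ x≤i) , λ {x} i<x → trans ([↦]-≢ (arrs τ a) (<⇒≢ i<x)) (todo (<⇒≤ i<x))
    where
    done′ : ∀ {x} → x < suc i → (arrs τ a [ i ↦ ⟦ e ⟧ τ ]) x ≡ f x
    done′ {x} x<1+i with x ≟ i
    ... | yes refl = trans ([↦]-≡ (arrs τ a) refl) (h i<N refl s (todo ≤-refl))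
    ... | no x≢i   = trans ([↦]-≢ (arrs τ a) (x≢i ∘ sym)) (done (≤∧≢⇒< (≤-pred x<1+i) x≢i))

-- Packing complements

total : (ℕ → ℕ) → List ℕ → ℕ
total g []      = 0
total g (p ∷ P) = g p + total g P

occ : ℕ → List ℕ → ℕ
occ j = total (δ j)

total≡0 : ∀ {g Q} → All (λ q → g q ≡ 0) Q → total g Q ≡ 0
total≡0 []       = refl
total≡0 (e ∷ es) = cong₂ _+_ e (total≡0 es)

total≢0 : ∀ {g} Q → total g Q ≢ 0 → Any (λ q → g q ≢ 0) Q
total≢0 []      h = contradiction refl h
total≢0 {g} (q ∷ Q) h with g q ≟ 0
... | yes gq≡0 = there (total≢0 Q λ e → h (cong₂ _+_ gq≡0 e))
... | no gq≢0  = here gq≢0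

length≡total : ∀ Q → length Q ≡ total (const 1) Q
length≡total []      = refl
length≡total (q ∷ Q) = cong suc (length≡total Q)

occ-above : ∀ {j Q} → All (_< j) Q → occ j Q ≡ 0
occ-above all< = total≡0 (All-map (δ-≢ ∘ <⇒≢) all<)

-- Grouping equal entries, index `j` contributes `g j` once per occurrence. Bounds on multiplicities
-- thereby become bounds on totals.
total-by-occ : ∀ {m} (g : ℕ → ℕ) Q → All (_< m) Q → total g Q ≡ Σ< m (λ j → occ j Q * g j)
total-by-occ {m} g []      []          = sym (Σ<-0 m)
total-by-occ {m} g (q ∷ Q) (q<m ∷ Q<m) = sym (begin
  Σ< m (λ j → (δ j q + occ j Q) * g j)                   ≡⟨ Σ<-cong m (λ j _ → *-distribʳ-+ (g j) (δ j q) (occ j Q)) ⟩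
  Σ< m (λ j → δ j q * g j + occ j Q * g j)               ≡⟨ Σ<-+ m _ _ ⟩
  Σ< m (λ j → δ j q * g j) + Σ< m (λ j → occ j Q * g j)  ≡⟨ cong₂ _+_ (Σ<-δ m q g q<m) (sym (total-by-occ g Q Q<m)) ⟩
  g q + total g Q                                        ∎)
  where open ≡-Reasoning

-- Quantifying `total≡` over all weights expresses equality of multisets: weight 1 yields lengths,
-- `δ j` multiplicities, and `miss` loads.
record Removal (R : ℕ → Set) (Q : List ℕ) : Set₁ where
  field
    picked  : ℕ
    rest    : List ℕ
    holds   : R picked
    total≡  : ∀ g → total g Q ≡ g picked + total g rest
    all     : ∀ {P : ℕ → Set} → All P Q → P picked × All P rest

remove : ∀ {R Q} → Any R Q → Removal R Q
remove {Q = q ∷ Q} (here r) = record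
  { picked = q ; rest = Q ; holds = r ; total≡ = λ g → refl ; all = λ { (p ∷ ps) → p , ps } }
remove {Q = q ∷ Q} (there any) = record
  { picked = picked ; rest = q ∷ rest ; holds = holds
  ; total≡ = λ g → trans (cong (g q +_) (total≡ g)) (x∙yz≈y∙xz (g q) (g picked) (total g rest))
  ; all = λ { (p ∷ ps) → let p′ , ps′ = all ps in p′ , p ∷ ps′ } }
  where open Removal (remove any)

-- Applied to a defect and a neighbourhood value, this is the indicator of the sets on which the
-- search branches.
child : ℕ → ℕ → ℕ
child zero (suc _) = 1
child _    _       = 0

child≤1 : ∀ x y → child x y ≤ 1
child≤1 zero    zero    = z≤n
child≤1 zero    (suc y) = ≤-refl
child≤1 (suc x) y       = z≤n

child≤ : ∀ x y → child x y ≤ y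
child≤ zero    zero    = z≤n
child≤ zero    (suc y) = s≤s z≤n
child≤ (suc x) y       = z≤n

-- 0/1-valued equality as the machine computes it
eqn : ℕ → ℕ → ℕ
eqn j p = 1 ∸ ((p ∸ j) + (j ∸ p))

eqn-refl : ∀ j → eqn j j ≡ 1
eqn-refl j rewrite n∸n≡0 j = refl

eqn-≢ : ∀ {j p} → p ≢ j → eqn j p ≡ 0
eqn-≢ {j} {p} p≢j = m≤n⇒m∸n≡0 (n≢0⇒n>0 λ e → p≢j
  (≤-antisym (m∸n≡0⇒m≤n (m+n≡0⇒m≡0 (p ∸ j) e)) (m∸n≡0⇒m≤n (m+n≡0⇒n≡0 (p ∸ j) e))))

Σ<-eqn : ∀ m j → Σ< m (eqn j) ≤ 1
Σ<-eqn zero    j = z≤n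
Σ<-eqn (suc m) j with m ≟ j
... | yes refl = ≤-reflexive (cong₂ _+_ (Σ<≡0 m λ i i<m → eqn-≢ (<⇒≢ i<m)) (eqn-refl m))
... | no m≢j   = subst (_≤ 1) (sym (trans (cong (Σ< m (eqn j) +_) (eqn-≢ m≢j)) (+-identityʳ _))) (Σ<-eqn m j)

module Packing (n m k : ℕ) (d : ℕ → ℕ) (miss : ℕ → ℕ → ℕ) (miss≤1 : ∀ j i → miss j i ≤ 1) where

  -- Counting the demand as load from the outset replaces the bounds `k - d i`, which vary with the
  -- element, by the single capacity `k`.
  load : List ℕ → ℕ → ℕ
  load P i = total (λ p → miss p i) P + d i

  load-∷ : ∀ p P i → load P i + miss p i ≡ load (p ∷ P) i
  load-∷ p P i = trans (+-comm (load P i) (miss p i)) (sym (+-assoc (miss p i) _ (d i)))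

  -- Zero exactly when `p` is unpicked and adding it keeps every load within `k`; in this form one
  -- summing loop decides validity.
  defect : List ℕ → ℕ → ℕ
  defect P p = occ p P + Σ< n (λ i → (load P i + miss p i) ∸ k)

  Valid : List ℕ → ℕ → Set
  Valid P p = defect P p ≡ 0

  valid-fresh : ∀ {P p} → Valid P p → occ p P ≡ 0
  valid-fresh {P} {p} = m+n≡0⇒m≡0 (occ p P)

  valid-fits : ∀ {P p} → Valid P p → ∀ {i} → i < n → load P i + miss p i ≤ k
  valid-fits {P} {p} v i<n = m∸n≡0⇒m≤n (n≤0⇒n≡0
    (≤-trans (term≤Σ< n _ i<n) (≤-reflexive (m+n≡0⇒n≡0 (occ p P) v))))

  valid : ∀ {P p} → occ p P ≡ 0 → (∀ {i} → i < n → load P i + miss p i ≤ k) → Valid P p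
  valid f h = cong₂ _+_ f (Σ<≡0 n λ i i<n → m≤n⇒m∸n≡0 (h i<n))

  Feasible : List ℕ → Set
  Feasible P = (∀ j → occ j P ≤ 1) × (∀ {i} → i < n → load P i ≤ k)

  δ+≤1 : ∀ {p x} j → x ≤ 1 → (p ≡ j → x ≡ 0) → δ j p + x ≤ 1
  δ+≤1 {p} j x≤1 h with p ≟ j
  ... | yes refl = ≤-reflexive (cong₂ _+_ (δ-refl j) (h refl))
  ... | no p≢j   = subst (λ y → y + _ ≤ 1) (sym (δ-≢ p≢j)) x≤1

  feasible-∷ : ∀ {P p} → Valid P p → Feasible P → Feasible (p ∷ P)
  feasible-∷ {P} {p} v (o , l) =
    (λ j → δ+≤1 {p} j (o j) λ { refl → valid-fresh {P} v }) ,
    (λ {i} i<n → subst (_≤ k) (load-∷ p P i) (valid-fits {P} v i<n))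

  -- In `fresh`, a single inequality excludes repetitions among the picks as well as sets already in
  -- `P`.
  record Extension (P : List ℕ) (r : ℕ) : Set where
    constructor extension
    field
      picks : List ℕ
      all<m : All (_< m) picks
      size  : length picks ≡ r
      fresh : ∀ j → occ j picks + occ j P ≤ 1
      fits  : ∀ {i} → i < n → total (λ p → miss p i) picks + load P i ≤ k

  open Extension

  feasible⇒extension : ∀ {P} → Feasible P → Extension P 0
  feasible⇒extension (o , l) = extension [] [] refl o l

  unpick : ∀ {P r p} → p < m → Extension (p ∷ P) r → Extension P (suc r)
  unpick {P} {r} {p} p<m (extension Q a s f h) = extension (p ∷ Q) (p<m ∷ a) (cong suc s)
    (λ j → subst (_≤ 1) (trans (x∙yz≈y∙xz (occ j Q) (δ j p) (occ j P)) (sym (+-assoc (δ j p) _ _))) (f j))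
    (λ {i} i<n → subst (_≤ k)
      (trans (cong (total (λ q → miss q i) Q +_) (+-assoc (miss p i) _ (d i)))
      (trans (x∙yz≈y∙xz (total (λ q → miss q i) Q) (miss p i) (load P i))
             (sym (+-assoc (miss p i) _ _)))) (h i<n))

  -- Any pick may be made next: all picks together respect the capacities and are distinct, hence so
  -- is `P` with this pick alone.
  pick : ∀ {R : ℕ → Set} {P r} (E : Extension P (suc r)) → Any R (picks E) →
    ∃[ p ] p < m × Valid P p × R p × Extension (p ∷ P) r
  pick {R} {P} {r} (extension Q a s f h) any = picked , proj₁ (all a)
    , valid {P} (n≤0⇒n≡0 (+-cancelˡ-≤ 1 _ _
                (≤-trans (+-monoˡ-≤ (occ picked P) 1≤occ) (f picked))))
            (λ {i} i<n → ≤-trans (≤-reflexive (+-comm (load P i) (miss picked i)))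
                         (≤-trans (+-monoˡ-≤ (load P i) (head≤ (λ q → miss q i))) (h i<n)))
    , holds
    , extension rest (proj₂ (all a)) size′
        (λ j → subst (_≤ 1) (trans (cong (_+ occ j P) (total≡ (δ j)))
                 (xy∙z≈y∙xz (δ j picked) (occ j rest) (occ j P))) (f j))
        (λ {i} i<n → subst (_≤ k) (trans (cong (_+ load P i) (total≡ (λ q → miss q i)))
             (trans (xy∙z≈y∙xz (miss picked i) (total (λ q → miss q i) rest) (load P i))
                    (cong (total (λ q → miss q i) rest +_) (sym (+-assoc (miss picked i) _ (d i))))))
             (h i<n))
    where
    open Removal (remove any)
    head≤ : ∀ g → g picked ≤ total g Q
    head≤ g = ≤-trans (m≤m+n _ _) (≤-reflexive (sym (total≡ g)))
    1≤occ : 1 ≤ occ picked Q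
    1≤occ = subst (_≤ occ picked Q) (δ-refl picked) (head≤ (δ picked))
    size′ : length rest ≡ r
    size′ = suc-injective (trans (cong suc (length≡total rest))
             (trans (sym (total≡ (const 1))) (trans (sym (length≡total Q)) s)))

  -- The size of the intersection of two complements: for bits, x + y minus 1, truncated, is the
  -- product x y.
  common : ℕ → ℕ → ℕ
  common j p = Σ< n (λ i → (miss j i + miss p i) ∸ 1)

  nbr : ℕ → ℕ → ℕ
  nbr j p = eqn j p + common j p

  nbr-refl : ∀ j → nbr j j ≢ 0
  nbr-refl j e = contradiction (trans (sym (eqn-refl j)) (m+n≡0⇒m≡0 (eqn j j) e)) λ ()

  nbr≡0⇒≢ : ∀ {j p} → nbr j p ≡ 0 → p ≢ j
  nbr≡0⇒≢ e refl = nbr-refl _ e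

  nbr≡0⇒disjoint : ∀ {j p} → nbr j p ≡ 0 → ∀ {i} → i < n → miss j i + miss p i ≤ 1
  nbr≡0⇒disjoint {j} {p} e i<n = m∸n≡0⇒m≤n (n≤0⇒n≡0
    (≤-trans (term≤Σ< n _ i<n) (≤-reflexive (m+n≡0⇒n≡0 (eqn j p) e))))

  -- The head of the picks gives way to `j`. On the complement of `j` no remaining pick adds load,
  -- so validity of `j` suffices there; elsewhere the load can only drop. Since `j` is its own
  -- neighbour, it is not among the remaining picks.
  exchange : ∀ {P r j} → Valid P j → (E : Extension P (suc r)) →
    All (λ q → nbr j q ≡ 0) (picks E) → Extension (j ∷ P) r
  exchange {P} {r} {j} v (extension (q ∷ Q) (q<m ∷ a) s f h) (_ ∷ far) =
    extension Q a (suc-injective s) fresh′ fits′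
    where
    fresh′ : ∀ x → occ x Q + (δ x j + occ x P) ≤ 1
    fresh′ x = subst (_≤ 1) (x∙yz≈y∙xz (δ x j) (occ x Q) (occ x P))
      (δ+≤1 {j} x (≤-trans (+-monoˡ-≤ (occ x P) (m≤n+m (occ x Q) (δ x q))) (f x))
              λ { refl → cong₂ _+_ (total≡0 (All-map (δ-≢ ∘ nbr≡0⇒≢) far)) (valid-fresh {P} v) })
    fits′ : ∀ {i} → i < n → total (λ p → miss p i) Q + load (j ∷ P) i ≤ k
    fits′ {i} i<n with miss j i in eq | load-∷ j P i
    ... | zero  | e = ≤-trans (+-monoˡ-≤ (load P i) (m≤n+m (total (λ p → miss p i) Q) (miss q i)))
                              (h i<n)
    ... | suc x | e = subst (λ y → y + (suc x + total (λ p → miss p i) P + d i) ≤ k)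
      (sym (total≡0 (All-map (λ {p} z → n≤0⇒n≡0 (m+n≤o⇒n≤o x (≤-pred
              (subst (λ y → y + miss p i ≤ 1) eq (nbr≡0⇒disjoint {j} {p} z i<n))))) far)))
      (subst (_≤ k) e (subst (λ y → load P i + y ≤ k) eq (valid-fits {P} v i<n)))

  -- The second alternative leaves `j` arbitrary: when no set is valid, the machine keeps the
  -- out-of-range value `m`, and no candidate becomes a child.
  Pivot : List ℕ → ℕ → Set
  Pivot P j = (j < m × Valid P j) ⊎ (∀ {p} → p < m → ¬ Valid P p)

  -- Replacing any pick by the pivot keeps a solution that avoids the pivot's
  -- closed neighbourhood feasible.
  branch : ∀ {P r j} → Pivot P j → Extension P (suc r) →
    ∃[ p ] p < m × Valid P p × nbr j p ≢ 0 × Extension (p ∷ P) r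
  branch {P} (inj₂ none) E@(extension (q ∷ Q) _ _ _ _)
    with p , p<m , v , _ ← pick {R = λ _ → ℕ} E (here 0) = contradiction v (none p<m)
  branch {P} {r} {j} (inj₁ (j<m , v)) E with any? (λ q → ¬? (nbr j q ≟ 0)) (picks E)
  ... | yes any = pick E any
  ... | no ¬any = j , j<m , v , nbr-refl j , exchange v E
        (All-map (λ {q} → decidable-stable (nbr j q ≟ 0)) (¬Any⇒All¬ _ ¬any))

  children : List ℕ → ℕ → ℕ → ℕ
  children P j p = child (defect P p) (nbr j p)

  common-self : ∀ j → common j j ≡ Σ< n (miss j)
  common-self j = Σ<-cong n λ i _ → lemma (miss j i) (miss≤1 j i)
    where
    lemma : ∀ x → x ≤ 1 → (x + x) ∸ 1 ≡ x
    lemma zero          _ = refl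
    lemma (suc zero)    _ = refl
    lemma (suc (suc x)) (s≤s ())

  -- Double counting of pairs: each of the at most `a` elements in the complement of `j` lies in at
  -- most `b` complements.
  common≤ : ∀ {a b} → (∀ {j} → j < m → Σ< n (miss j) ≤ a) →
    (∀ {i} → i < n → Σ< m (λ p → miss p i) ≤ b) → ∀ {j} → j < m → Σ< m (common j) ≤ a * b
  common≤ {a} {b} row col {j} j<m = begin
    Σ< m (common j)                                          ≡⟨ Σ<-swap m n _ ⟩
    Σ< n (λ i → Σ< m (λ p → (miss j i + miss p i) ∸ 1))      ≤⟨ Σ<-mono n (λ i _ → Σ<-mono m λ p _ →
                                                                 product (miss j i) (miss p i) (miss≤1 j i) (miss≤1 p i)) ⟩
    Σ< n (λ i → Σ< m (λ p → miss j i * miss p i))            ≡⟨ Σ<-cong n (λ i _ → Σ<-*ˡ m (miss j i) (λ p → miss p i)) ⟩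
    Σ< n (λ i → miss j i * Σ< m (λ p → miss p i))            ≤⟨ Σ<-mono n (λ i i<n → *-monoʳ-≤ (miss j i) (col i<n)) ⟩
    Σ< n (λ i → miss j i * b)                                ≡⟨ Σ<-*ʳ n b (miss j) ⟩
    Σ< n (miss j) * b                                        ≤⟨ *-monoˡ-≤ b (row j<m) ⟩
    a * b                                                    ∎
    where
    open ≤-Reasoning
    product : ∀ x z → x ≤ 1 → z ≤ 1 → (x + z) ∸ 1 ≤ x * z
    product zero          z _ z≤1 = ≤-reflexive (m≤n⇒m∸n≡0 z≤1)
    product (suc zero)    z _ _ = ≤-reflexive (sym (+-identityʳ z))
    product (suc (suc x)) z (s≤s ()) _

  -- If the complement of `j` is nonempty, it meets itself, so the count of intersections pays for
  -- the child `j` too and a b suffices. If it is empty, `j` is the only possible child; this is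
  -- where the 1 in max(1, a b) comes from.
  children≤ : ∀ {a b c} → (∀ {j} → j < m → Σ< n (miss j) ≤ a) →
    (∀ {i} → i < n → Σ< m (λ p → miss p i) ≤ b) → 1 ≤ c → a * b ≤ c →
    ∀ {P j} → Pivot P j → Σ< m (children P j) ≤ c
  children≤ row col 1≤c ab≤c {P} {j} (inj₂ none) =
    ≤-trans (≤-reflexive (Σ<≡0 m λ p p<m → not-child (none p<m) (nbr j p))) z≤n
    where
    not-child : ∀ {x} → x ≢ 0 → ∀ y → child x y ≡ 0
    not-child {zero}  h y = contradiction refl h
    not-child {suc x} h y = refl
  children≤ row col 1≤c ab≤c {P} {j} (inj₁ (j<m , v)) with Σ< n (miss j) ≟ 0
  ... | yes full = ≤-trans (Σ<-mono m λ p _ → ≤-trans (child≤ (defect P p) (nbr j p))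
                     (≤-reflexive (trans (cong (eqn j p +_) (common≡0 p)) (+-identityʳ _))))
                   (≤-trans (Σ<-eqn m j) 1≤c)
    where
    common≡0 : ∀ p → common j p ≡ 0
    common≡0 p = Σ<≡0 n λ i i<n → m≤n⇒m∸n≡0 (subst (λ x → x + miss p i ≤ 1)
      (sym (n≤0⇒n≡0 (≤-trans (term≤Σ< n (miss j) i<n) (≤-reflexive full)))) (miss≤1 p i))
  ... | no ¬full = ≤-trans (Σ<-mono m λ p _ → child≤common p) (≤-trans (common≤ row col j<m) ab≤c)
    where
    child≤common : ∀ p → children P j p ≤ common j p
    child≤common p with p ≟ j
    ... | yes refl = ≤-trans (child≤1 (defect P p) (nbr j p))
                       (n≢0⇒n>0 (subst (_≢ 0) (sym (common-self j)) ¬full))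
    ... | no p≢j = ≤-trans (child≤ (defect P p) (nbr j p)) (≤-reflexive (cong (_+ common j p) (eqn-≢ p≢j)))

  -- Pairwise disjoint complements

  valid-count : ℕ
  valid-count = Σ< m (λ p → 1 ∸ defect [] p)

  -- The picks are distinct, and each of them fits alone because leaving out the others only lowers
  -- the loads. Disjointness enters only in the converse.
  extension⇒valid-count : Extension [] k → k ≤ valid-count
  extension⇒valid-count (extension Q a s f h) = begin
    k                           ≡⟨ sym s ⟩
    length Q                    ≡⟨ length≡total Q ⟩
    total (const 1) Q           ≡⟨ total-by-occ (const 1) Q a ⟩
    Σ< m (λ j → occ j Q * 1)    ≤⟨ Σ<-mono m (λ j → occ≤ j) ⟩
    valid-count                 ∎
    where
    open ≤-Reasoning
    occ≤ : ∀ j → j < m → occ j Q * 1 ≤ 1 ∸ defect [] j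
    occ≤ j j<m with occ j Q ≟ 0
    ... | yes e = subst (λ x → x * 1 ≤ 1 ∸ defect [] j) (sym e) z≤n
    ... | no ≢0 = subst₂ _≤_ (sym (*-identityʳ (occ j Q))) (cong (1 ∸_) (sym (valid {[]} refl v)))
                   (subst (_≤ 1) (+-identityʳ _) (f j))
      where
      v : ∀ {i} → i < n → load [] i + miss j i ≤ k
      v {i} i<n = ≤-trans (≤-trans (≤-reflexive (+-comm (d i) (miss j i))) (+-monoˡ-≤ (d i) (begin
        miss j i                          ≤⟨ m≤n*m (miss j i) (occ j Q) {{≢-nonZero ≢0}} ⟩
        occ j Q * miss j i                ≤⟨ term≤Σ< m (λ j → occ j Q * miss j i) j<m ⟩
        Σ< m (λ j → occ j Q * miss j i)   ≡⟨ sym (total-by-occ (λ p → miss p i) Q a) ⟩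
        total (λ p → miss p i) Q          ∎))) (h i<n)

  -- Collecting from the largest index downwards makes distinctness immediate: all other entries lie
  -- below the one just added.
  valid-list : ∀ r M → r ≤ Σ< M (λ p → 1 ∸ defect [] p) →
    Σ[ Q ∈ List ℕ ] length Q ≡ r × All (_< M) Q × All (Valid []) Q × (∀ j → occ j Q ≤ 1)
  valid-list zero    M       _ = [] , refl , [] , [] , λ _ → z≤n
  valid-list (suc r) (suc M) h with defect [] M in eq
  ... | suc x with Q , s , a , v , f ← valid-list (suc r) M (subst (suc r ≤_) (trans (cong (Σ< M (λ p → 1 ∸ defect [] p) +_) (0∸n≡0 x)) (+-identityʳ _)) h)
    = Q , s , All-map m<n⇒m<1+n a , v , f
  ... | zero with Q , s , a , v , f ← valid-list r M (≤-pred (subst (suc r ≤_) (+-comm _ 1) h))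
    = M ∷ Q , cong suc s , ≤-refl ∷ All-map m<n⇒m<1+n a , eq ∷ v
    , λ j → δ+≤1 {M} j (f j) λ { refl → occ-above a }

  -- At most one pick burdens a given element. Without one the load is the demand; with one it is
  -- the load that this pick, being valid alone, already respects.
  valid-count⇒extension : (∀ {i} → i < n → Σ< m (λ p → miss p i) ≤ 1) →
    (∀ {i} → i < n → d i ≤ k) → k ≤ valid-count → Extension [] k
  valid-count⇒extension col d≤k h with Q , s , a , v , f ← valid-list k m h =
    extension Q a s (λ j → subst (_≤ 1) (sym (+-identityʳ _)) (f j)) fits′
    where
    open ≤-Reasoning
    fits′ : ∀ {i} → i < n → total (λ p → miss p i) Q + load [] i ≤ k
    fits′ {i} i<n with total (λ p → miss p i) Q ≟ 0
    ... | yes e = subst (λ x → x + d i ≤ k) (sym e) (d≤k i<n)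
    ... | no ≢0 = begin
      total (λ p → miss p i) Q + d i  ≤⟨ +-monoˡ-≤ (d i) total≤1 ⟩
      1 + d i                         ≤⟨ +-monoˡ-≤ (d i) (n≢0⇒n>0 holds) ⟩
      miss picked i + d i             ≡⟨ +-comm (miss picked i) (d i) ⟩
      d i + miss picked i             ≤⟨ valid-fits {[]} (proj₁ (all v)) i<n ⟩
      k                               ∎
      where
      open Removal (remove (total≢0 Q ≢0))
      total≤1 : total (λ p → miss p i) Q ≤ 1
      total≤1 = begin
        total (λ p → miss p i) Q         ≡⟨ total-by-occ (λ p → miss p i) Q a ⟩
        Σ< m (λ j → occ j Q * miss j i)  ≤⟨ Σ<-mono m (λ j _ → ≤-trans (*-monoˡ-≤ (miss j i) (f j)) (≤-reflexive (*-identityˡ (miss j i)))) ⟩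
        Σ< m (λ j → miss j i)            ≤⟨ col i<n ⟩
        1                                ∎

-- Programs and specifications

-- Registers 3, 6, 7, 8 hold the number of picks still to be made, the current
-- set, the pivot and a flag that the search is running; 4, 5, 9 are scratch.
-- Array 0 holds the current loads, 2 marks the picked sets, 5 the addresses of
-- the rows of the incidence matrix, and 3, 4 the pivot and the current branch
-- of every level of the search, indexed by the number of picks to be made.

missing : Expr → Expr → Expr
missing j i = lit 1 ⊖ 1 [ 5 [ j ] ⊕ i ]

-- Each pass of `body` treats one candidate of the current level. A level with all candidates
-- treated returns to its parent, unless it is the root, recognised by `k` picks remaining, where
-- the search ends.
test neighbour findPivot enter next push undo pop body : Cmd

test = 5 ≔ 2 [ reg 6 ] ⨾ sumLoop 0 ((0 [ reg 4 ] ⊕ missing (reg 6) (reg 4)) ⊖ reg 2)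

neighbour =
  5 ≔ lit 1 ⊖ ((reg 6 ⊖ reg 7) ⊕ (reg 7 ⊖ reg 6)) ⨾
  sumLoop 0 ((missing (reg 7) (reg 4) ⊕ missing (reg 6) (reg 4)) ⊖ lit 1)

-- The initial value `m` stands for the absence of a valid set.
findPivot = 7 ≔ reg 1 ⨾ for 6 1 (test ⨾ if (reg 5) skip (7 ≔ reg 6))

enter = if (reg 3) (findPivot ⨾ 3 [ reg 3 ]≔ reg 7 ⨾ 4 [ reg 3 ]≔ lit 0) (8 ≔ lit 0)

next = 4 [ reg 3 ]≔ reg 6 ⊕ lit 1

push =
  2 [ reg 6 ]≔ lit 1 ⨾
  mapLoop 0 0 (0 [ reg 4 ] ⊕ missing (reg 6) (reg 4)) ⨾
  3 ≔ reg 3 ⊖ lit 1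

undo =
  2 [ reg 6 ]≔ lit 0 ⨾
  mapLoop 0 0 (0 [ reg 4 ] ⊖ missing (reg 6) (reg 4)) ⨾
  next

-- `push` leaves the branch slot of the parent at the chosen set, so array 4 doubles as the stack of
-- picks.
pop = 3 ≔ reg 3 ⊕ lit 1 ⨾ 6 ≔ 4 [ reg 3 ] ⨾ undo

body =
  6 ≔ 4 [ reg 3 ] ⨾
  7 ≔ 3 [ reg 3 ] ⨾
  if (reg 1 ⊖ reg 6)
    (test ⨾ if (reg 5) next (neighbour ⨾ if (reg 5) (push ⨾ enter) next))
    (if (reg 2 ⊖ reg 3) pop (8 ≔ lit 0))

touchesInput : Cmd → Bool
touchesInput c = writesReg c 0 ∨ (writesReg c 1 ∨ (writesReg c 2 ∨ (writesArr c 1 ∨ writesArr c 5)))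

-- Specifications of the subroutines

module Search (n m k : ℕ) (1≤n : 1 ≤ n) (1≤m : 1 ≤ m) (d inc base : ℕ → ℕ) where

  miss : ℕ → ℕ → ℕ
  miss j i = 1 ∸ inc (base j + i)

  open Packing n m k d miss (λ j i → m∸n≤m 1 (inc (base j + i))) public

  record Env (σ : State) : Set where
    constructor env
    field
      n≡    : regs σ 0 ≡ n
      m≡    : regs σ 1 ≡ m
      k≡    : regs σ 2 ≡ k
      inc≡  : arrs σ 1 ≡ inc
      base≡ : arrs σ 5 ≡ base

  open Env public

  record Holds (P : List ℕ) (σ : State) : Set where
    constructor holds
    field
      load≡ : ∀ {i} → i < n → arrs σ 0 i ≡ load P i
      occ≡  : ∀ {j} → j < m → arrs σ 2 j ≡ occ j P

  open Holds public

  env-same : ∀ {c σ τ} → touchesInput c ≡ false → Same c σ τ → Env σ → Env τ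
  env-same {c} h s (env n≡ m≡ k≡ inc≡ base≡) =
    let h₁ = ∨-falseʳ (writesReg c 0) h
        h₂ = ∨-falseʳ (writesReg c 1) h₁
        h₃ = ∨-falseʳ (writesReg c 2) h₂
    in env (trans (regs≡ s 0 (∨-falseˡ _ h)) n≡) (trans (regs≡ s 1 (∨-falseˡ _ h₁)) m≡)
           (trans (regs≡ s 2 (∨-falseˡ _ h₂)) k≡) (trans (arrs≡ s 1 (∨-falseˡ _ h₃)) inc≡)
           (trans (arrs≡ s 5 (∨-falseʳ (writesArr c 1) h₃)) base≡)

  holds-same : ∀ {c σ τ P} → writesArr c 0 ∨ writesArr c 2 ≡ false → Same c σ τ → Holds P σ → Holds P τ
  holds-same {c} h s (holds l o) =
    holds (λ {i} i<n → trans (cong (λ f → f i) (arrs≡ s 0 (∨-falseˡ _ h))) (l i<n))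
          (λ {j} j<m → trans (cong (λ f → f j) (arrs≡ s 2 (∨-falseʳ (writesArr c 0) h))) (o j<m))

  miss-eval : ∀ {τ j i x y} → Env τ → x ≡ j → y ≡ i → 1 ∸ arrs τ 1 (arrs τ 5 x + y) ≡ miss j i
  miss-eval E refl refl rewrite inc≡ E | base≡ E = refl

  -- As `n` is positive, an additive constant is absorbed by a multiple of `n`. The implicit side
  -- condition is solved by evaluation.
  linear : ∀ a b {c} → {T (a + b ≤ᵇ c)} → a + n * b ≤ n * c
  linear a b {c} {h} = begin
    a + n * b      ≤⟨ +-monoˡ-≤ (n * b) (m≤n*m a n {{>-nonZero 1≤n}}) ⟩
    n * a + n * b  ≡⟨ sym (*-distribˡ-+ n a b) ⟩
    n * (a + b)    ≤⟨ *-monoʳ-≤ n (≤ᵇ⇒≤ (a + b) c h) ⟩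
    n * c          ∎
    where open ≤-Reasoning

  -- The assignment costs 3 and the sum 6 + 23 n. The constant 40, like the later ones, is rounded
  -- up.
  test-spec : ∀ {σ P p} → Env σ → Holds P σ → regs σ 6 ≡ p → p < m →
    Run test σ (n * 40) (λ τ → regs τ 5 ≡ defect P p)
  test-spec {σ} {P} {p} E H 6≡p p<m = weaken (linear 9 23)
    (reg-seq {e = 2 [ reg 6 ]} (consequence (λ _ e → trans e (cong (_+ Σ< n f) (trans (cong (arrs σ 2) 6≡p) (occ≡ H p<m))))
      (sum-rule f (n≡ E) refl refl λ {i} {τ} i<n 4≡i s →
        cong₂ _∸_ (cong₂ _+_ (trans (cong₂ (λ f x → f x) (arrs≡ s 0 refl) 4≡i) (load≡ H i<n))
                             (miss-eval (env-same refl s (env-same {c = 5 ≔ lit 0} refl (same-setReg 5 _ λ _ h → h) E))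
                                        (trans (regs≡ s 6 refl) 6≡p) 4≡i))
                  (trans (regs≡ s 2 refl) (k≡ E)))))
    where
    f : ℕ → ℕ
    f i = (load P i + miss p i) ∸ k

  linear₂ : ∀ a b {s c} → s ≤ n * b → {T (a + b ≤ᵇ c)} → a + m * s ≤ m * (n * c)
  linear₂ a b {s} {c} s≤ {h} = begin
    a + m * s              ≤⟨ +-mono-≤ (≤-trans (m≤n*m a n {{>-nonZero 1≤n}}) (m≤n*m (n * a) m {{>-nonZero 1≤m}})) (*-monoʳ-≤ m s≤) ⟩
    m * (n * a) + m * (n * b)  ≡⟨ sym (*-distribˡ-+ m (n * a) (n * b)) ⟩
    m * (n * a + n * b)    ≡⟨ cong (m *_) (sym (*-distribˡ-+ n a b)) ⟩
    m * (n * (a + b))      ≤⟨ *-monoʳ-≤ m (*-monoʳ-≤ n (≤ᵇ⇒≤ (a + b) c h)) ⟩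
    m * (n * c)            ∎
    where open ≤-Reasoning

  env-setReg : ∀ {σ} x v → touchesInput (x ≔ lit v) ≡ false → Env σ → Env (setReg x v σ)
  env-setReg x v h = env-same {c = x ≔ lit v} h (same-setReg x v λ _ e → e)

  neighbour-spec : ∀ {σ j p} → Env σ → regs σ 6 ≡ p → regs σ 7 ≡ j →
    Run neighbour σ (n * 50) (λ τ → regs τ 5 ≡ nbr j p)
  neighbour-spec {σ} {j} {p} E 6≡p 7≡j = weaken (linear 16 28)
    (reg-seq (consequence (λ _ e → trans e (cong (_+ common j p) (cong₂ eqn 7≡j 6≡p)))
      (sum-rule _ (n≡ E) refl refl λ {i} {τ} i<n 4≡i s →
        let E′ = env-same refl s (env-setReg 5 (eqn (regs σ 7) (regs σ 6)) refl E) in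
        cong (_∸ 1) (cong₂ _+_ (miss-eval E′ (trans (regs≡ s 7 refl) 7≡j) 4≡i)
                               (miss-eval E′ (trans (regs≡ s 6 refl) 6≡p) 4≡i)))))

  findPivot-spec : ∀ {σ P} → Env σ → Holds P σ →
    Run findPivot σ (m * (n * 80)) (λ τ → Pivot P (regs τ 7))
  findPivot-spec {σ} {P} E H = weaken (linear₂ 8 58 (linear 8 50))
    (reg-seq (for-rule {S = n * 50} Inv (m≡ E) refl refl refl
        (λ {i} {τ} i<m 6≡i s inv → weaken step≤
          (test-spec (env-same refl s E₁) (holds-same refl s H₁) 6≡i i<m then (λ {υ} s′ 5≡ →
            branches i<m (trans (regs≡ s′ 6 refl) 6≡i) 5≡
              (subst (λ x → Found i x) (sym (regs≡ s′ 7 refl)) inv))))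
        (inj₂ (λ ()))))
    where
    σ₁ = setReg 7 (regs σ 1) σ
    E₁ = env-setReg 7 (regs σ 1) refl E
    H₁ : Holds P σ₁
    H₁ = holds (load≡ H) (occ≡ H)
    -- The invariant is `Pivot` restricted to the first `i` candidates; it becomes `Pivot` itself at
    -- `i = m`.
    Found : ℕ → ℕ → Set
    Found i x = (x < m × Valid P x) ⊎ (∀ {p} → p < i → ¬ Valid P p)
    Inv : ℕ → State → Set
    Inv i τ = Found i (regs τ 7)
    step≤ : n * 40 + 6 ≤ n * 50
    step≤ = ≤-trans (≤-reflexive (+-comm (n * 40) 6)) (linear 6 40)
    branches : ∀ {i υ} → i < m → regs υ 6 ≡ i → regs υ 5 ≡ defect P i → Found i (regs υ 7) →
      Run (if (reg 5) skip (7 ≔ reg 6)) υ 6 (λ τ → Inv (suc i) (setReg 6 (suc i) τ))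
    branches {i} {υ} i<m 6≡i 5≡ inv with defect P i ≟ 0
    ... | yes v = weaken (≤ᵇ⇒≤ _ _ _) (else-rule (trans 5≡ v)
                    (reg-rule (inj₁ (subst (λ x → x < m × Valid P x) (sym 6≡i) (i<m , v)))))
    ... | no ¬v = weaken (≤ᵇ⇒≤ _ _ _) (then-rule (λ e → ¬v (trans (sym 5≡) e)) (skip-rule (extend inv)))
      where
      extend : Found i (regs υ 7) → Found (suc i) (regs υ 7)
      extend (inj₁ x) = inj₁ x
      extend (inj₂ h) = inj₂ λ {p} p≤i v → case-≤ (m≤n⇒m<n∨m≡n (≤-pred p≤i)) v
        where
        case-≤ : ∀ {p} → p < i ⊎ p ≡ i → ¬ Valid P p
        case-≤ (inj₁ p<i) v  = h p<i v
        case-≤ (inj₂ refl) v = ¬v v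

  -- Levels are indexed by the picks remaining, so larger indices belong to ancestors, whose slots
  -- must survive the exploration of a subtree.
  record Above (r : ℕ) (σ τ : State) : Set where
    constructor above
    field
      unchanged : ∀ {x} → r < x → arrs τ 3 x ≡ arrs σ 3 x × arrs τ 4 x ≡ arrs σ 4 x

  open Above public

  above-refl : ∀ {r σ} → Above r σ σ
  above-refl = above λ _ → refl , refl

  above-trans : ∀ {r σ τ υ} → Above r σ τ → Above r τ υ → Above r σ υ
  above-trans f g = above λ r<x →
    trans (proj₁ (unchanged g r<x)) (proj₁ (unchanged f r<x)) ,
    trans (proj₂ (unchanged g r<x)) (proj₂ (unchanged f r<x))

  above-suc : ∀ {r σ τ} → Above r σ τ → Above (suc r) σ τ
  above-suc f = above λ r<x → unchanged f (<-trans ≤-refl r<x)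

  push-spec : ∀ {σ P p r} → Env σ → Holds P σ → regs σ 6 ≡ p → p < m → occ p P ≡ 0 → regs σ 3 ≡ suc r →
    Run push σ (n * 33) (λ τ → Holds (p ∷ P) τ × regs τ 3 ≡ r)
  push-spec {σ} {P} {p} {r} E H refl p<m p∉P 3≡ =
    weaken (≤-trans (≤-reflexive (cong (9 +_) (+-comm (n * 20) 4))) (linear 13 20))
    (arr-seq
      (map-rule (load (p ∷ P)) (n≡ E) refl (λ {i} {τ} i<n 4≡i s 0≡ →
          trans (cong₂ _+_ (trans (cong (arrs τ 0) 4≡i) (trans 0≡ (load≡ H i<n)))
                           (miss-eval (env-same {σ = σ₁} refl s (env (n≡ E) (m≡ E) (k≡ E) (inc≡ E) (base≡ E)))
                                      (regs≡ s 6 refl) 4≡i))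
                (load-∷ p P i))
       then (λ {τ} s l → reg-rule
         ( holds l (λ {j} j<m → trans (cong (λ f → f j) (arrs≡ s 2 refl)) (occ′ j<m))
         , cong (_∸ 1) (trans (regs≡ s 3 refl) 3≡)))))
    where
    σ₁ = setArr 2 p 1 σ
    occ′ : ∀ {j} → j < m → (arrs σ 2 [ p ↦ 1 ]) j ≡ occ j (p ∷ P)
    occ′ {j} j<m with p ≟ j
    ... | yes refl = trans ([↦]-≡ (arrs σ 2) refl) (sym (cong₂ _+_ (δ-refl p) p∉P))
    ... | no p≢j   = trans ([↦]-≢ (arrs σ 2) p≢j)
                     (trans (occ≡ H j<m) (sym (cong (_+ occ j P) (δ-≢ p≢j))))

  -- Truncated subtraction is exact here because the load includes the very term that is subtracted.
  -- Clearing the mark is right because `p` does not occur in `P`.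
  undo-spec : ∀ {σ P p r} → Env σ → Holds (p ∷ P) σ → regs σ 6 ≡ p → occ p P ≡ 0 → regs σ 3 ≡ r →
    Run undo σ (n * 34) (λ τ → Holds P τ × regs τ 3 ≡ r × arrs τ 4 r ≡ suc p × Above r σ τ)
  undo-spec {σ} {P} {p} {r} E H refl p∉P 3≡ =
    weaken (≤-trans (≤-reflexive (cong (9 +_) (+-comm (n * 20) 5))) (linear 14 20))
    (arr-seq
      (map-rule (load P) (n≡ E) refl (λ {i} {τ} i<n 4≡i s 0≡ →
          trans (cong₂ _∸_ (trans (cong (arrs τ 0) 4≡i) (trans 0≡ (trans (load≡ H i<n) (sym (load-∷ p P i)))))
                           (miss-eval (env-same {σ = σ₁} refl s (env (n≡ E) (m≡ E) (k≡ E) (inc≡ E) (base≡ E)))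
                                      (regs≡ s 6 refl) 4≡i))
                (m+n∸n≡m (load P i) (miss p i)))
       then (λ {τ} s l → let 3≡′ = trans (regs≡ s 3 refl) 3≡ in arr-rule
         ( holds l (λ {j} j<m → trans (cong (λ f → f j) (arrs≡ s 2 refl)) (occ′ j<m))
         , 3≡′
         , trans ([↦]-≡ (arrs τ 4) 3≡′) (trans (cong (_+ 1) (regs≡ s 6 refl)) (+-comm _ 1))
         , above λ {x} r<x → cong (λ f → f x) (arrs≡ s 3 refl)
                     , trans ([↦]-≢ (arrs τ 4) (λ e → <⇒≢ r<x (trans (sym 3≡′) e)))
                             (cong (λ f → f x) (arrs≡ s 4 refl))))))
    where
    σ₁ = setArr 2 p 0 σ
    occ′ : ∀ {j} → j < m → (arrs σ 2 [ p ↦ 0 ]) j ≡ occ j P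
    occ′ {j} j<m with p ≟ j
    ... | yes refl = trans ([↦]-≡ (arrs σ 2) refl) (sym p∉P)
    ... | no p≢j   = trans ([↦]-≢ (arrs σ 2) p≢j)
                     (trans (occ≡ H j<m) (cong (_+ occ j P) (δ-≢ p≢j)))

  pop-spec : ∀ {σ P p r} → Env σ → Holds (p ∷ P) σ → regs σ 3 ≡ r → arrs σ 4 (suc r) ≡ p → occ p P ≡ 0 →
    Run pop σ (n * 41) (λ τ → Holds P τ × regs τ 3 ≡ suc r × arrs τ 4 (suc r) ≡ suc p × Above (suc r) σ τ)
  pop-spec {σ} {P} {p} {r} E H 3≡ 4≡ p∉P = weaken (linear 7 34)
    (reg-seq (reg-seq (consequence (λ _ (H , r≡ , p≡ , f) → H , r≡ , p≡ , above (unchanged f)) (undo-spec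
      (env-setReg 6 _ refl (env-setReg 3 _ refl E)) (holds (load≡ H) (occ≡ H))
      (trans (cong (arrs σ 4) 3≡′) 4≡) p∉P 3≡′))))
    where
    3≡′ : regs σ 3 + 1 ≡ suc r
    3≡′ = trans (+-comm _ 1) (cong suc 3≡)

  enter-stop : ∀ {σ} → regs σ 3 ≡ 0 → Run enter σ 4 (λ τ → regs τ 8 ≡ 0)
  enter-stop 3≡0 = else-rule 3≡0 (reg-rule refl)

  enter-spec : ∀ {σ P r} → Env σ → Holds P σ → regs σ 3 ≡ suc r → Run enter σ (m * (n * 100))
    (λ τ → ∃[ j ] Pivot P j × arrs τ 3 (suc r) ≡ j × arrs τ 4 (suc r) ≡ 0 × regs τ 8 ≡ regs σ 8 × Above (suc r) σ τ)
  enter-spec {σ} {P} {r} E H 3≡ = weaken bound≤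
    (then-rule (λ e → contradiction (trans (sym 3≡) e) λ ())
      (findPivot-spec E H then λ {τ} s piv → let 3≡′ = trans (regs≡ s 3 refl) 3≡ in
        arr-seq (arr-rule
          ( regs τ 7 , piv
          , [↦]-≡ (arrs τ 3) 3≡′
          , [↦]-≡ (arrs τ 4) 3≡′
          , regs≡ s 8 refl
          , above λ {x} r<x → let r≢x = λ e → <⇒≢ r<x (trans (sym 3≡′) e) in
              trans ([↦]-≢ (arrs τ 3) r≢x) (cong (λ f → f x) (arrs≡ s 3 refl))
            , trans ([↦]-≢ (arrs τ 4) r≢x) (cong (λ f → f x) (arrs≡ s 4 refl))))))
    where
    bound≤ : 2 + (m * (n * 80) + 6) ≤ m * (n * 100)
    bound≤ = ≤-trans (≤-reflexive (cong (2 +_) (+-comm (m * (n * 80)) 6))) (linear₂ 8 80 ≤-refl)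

-- Partial runs of the main loop

loop : Cmd
loop = while (reg 8) body

-- A first part of the iterations of loop, given by how it prolongs runs from its end.
record Steps (σ : State) (S : ℕ) (Q : State → Set) : Set where
  constructor steps
  field
    {end}  : State
    {time} : ℕ
    resume : ∀ {υ t} → loop , end ⇓ υ ⟨ t ⟩ → loop , σ ⇓ υ ⟨ time + t ⟩
    bound  : time ≤ S
    post   : Q end

iterate : ∀ {σ S Q} → regs σ 8 ≡ 1 → Run body σ S Q → Steps σ (2 + S) Q
iterate 8≡1 (mkRun x b q) =
  steps (λ y → ⇓loop (λ e → contradiction (trans (sym 8≡1) e) λ ()) x y) (+-monoʳ-≤ 2 b) q

infixl 2 _andThen_ _finally_
_andThen_ : ∀ {σ S S′ Q R} (s : Steps σ S Q) → Steps (Steps.end s) S′ R → Steps σ (S + S′) R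
_andThen_ {σ} (steps {_} {t} f b q) (steps {_} {t′} f′ b′ r) =
  steps (λ {υ} {u} y → subst (λ x → loop , σ ⇓ υ ⟨ x ⟩) (sym (+-assoc t t′ u)) (f (f′ y))) (+-mono-≤ b b′) r

_finally_ : ∀ {σ S S′ Q R} (s : Steps σ S Q) → Run loop (Steps.end s) S′ R → Run loop σ (S + S′) R
steps f b q finally mkRun x b′ r = mkRun (f x) (+-mono-≤ b b′) r

weakenSteps : ∀ {σ S S′ Q R} → S ≤ S′ → (∀ {τ} → Q τ → R τ) → Steps σ S Q → Steps σ S′ R
weakenSteps h g (steps f b q) = steps f (≤-trans b h) (g q)

halt : ∀ {σ Q} → regs σ 8 ≡ 0 → Q σ → Run loop σ 2 Q
halt 8≡0 q = mkRun (⇓stop 8≡0) ≤-refl q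

-- Unlike `Σ<`, this sum sheds its first term, matching a scan that treats candidates in increasing
-- order.
Σ-from : ℕ → ℕ → (ℕ → ℕ) → ℕ
Σ-from p zero    f = 0
Σ-from p (suc q) f = f p + Σ-from (suc p) q f

Σ<-split : ∀ p q f → Σ< p f + Σ-from p q f ≡ Σ< (p + q) f
Σ<-split p zero    f = trans (+-identityʳ _) (cong (λ x → Σ< x f) (sym (+-identityʳ p)))
Σ<-split p (suc q) f = trans (sym (+-assoc (Σ< p f) (f p) _))
  (trans (Σ<-split (suc p) q f) (cong (λ x → Σ< x f) (sym (+-suc p q))))

-- Single iterations of the search

module DepthFirst (n m k : ℕ) (1≤n : 1 ≤ n) (1≤m : 1 ≤ m) (d inc base : ℕ → ℕ) where

  open Search n m k 1≤n 1≤m d inc base public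

  record At (P : List ℕ) (r : ℕ) (σ : State) : Set where
    constructor at
    field
      environment : Env σ
      loads       : Holds P σ
      remaining   : regs σ 3 ≡ r
      running     : regs σ 8 ≡ 1

  open At

  Slot : ℕ → ℕ → ℕ → State → Set
  Slot r j p σ = arrs σ 3 r ≡ j × arrs σ 4 r ≡ p

  slot-above : ∀ {r j p r′ σ τ} → r′ < r → Above r′ σ τ → Slot r j p σ → Slot r j p τ
  slot-above r′<r f (j≡ , p≡) =
    trans (proj₁ (unchanged f r′<r)) j≡ , trans (proj₂ (unchanged f r′<r)) p≡

  -- Collects what survives `test` and `neighbour`, which write only scratch registers, so that one
  -- frame lemma carries all of it.
  record Fetched (P : List ℕ) (r j p : ℕ) (σ τ : State) : Set where
    constructor fetched
    field
      current    : At P r τ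
      slot    : Slot r j p τ
      set≡    : regs τ 6 ≡ p
      pivot≡  : regs τ 7 ≡ j
      pivots≡ : arrs τ 3 ≡ arrs σ 3
      branch≡ : arrs τ 4 ≡ arrs σ 4

  open Fetched

  touchesSearch : Cmd → Bool
  touchesSearch c =
    writesArr c 3 ∨ (writesArr c 4 ∨ (writesReg c 3 ∨ (writesReg c 6 ∨ (writesReg c 7 ∨ writesReg c 8))))

  fetched-same : ∀ {c P r j p σ τ υ} → touchesInput c ≡ false → writesArr c 0 ∨ writesArr c 2 ≡ false →
    touchesSearch c ≡ false → Same c τ υ → Fetched P r j p σ τ → Fetched P r j p σ υ
  fetched-same {c} {r = r} h₀ h₁ h s (fetched (at E H 3≡ 8≡) (j≡ , p≡) 6≡ 7≡ a≡ b≡) =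
    let g₁ = ∨-falseʳ (writesArr c 3) h
        g₂ = ∨-falseʳ (writesArr c 4) g₁
        g₃ = ∨-falseʳ (writesReg c 3) g₂
        g₄ = ∨-falseʳ (writesReg c 6) g₃
        3∉ = arrs≡ s 3 (∨-falseˡ _ h)
        4∉ = arrs≡ s 4 (∨-falseˡ _ g₁)
    in fetched
      (at (env-same h₀ s E) (holds-same h₁ s H) (trans (regs≡ s 3 (∨-falseˡ _ g₂)) 3≡)
          (trans (regs≡ s 8 (∨-falseʳ (writesReg c 7) g₄)) 8≡))
      (trans (cong (λ f → f r) 3∉) j≡ , trans (cong (λ f → f r) 4∉) p≡)
      (trans (regs≡ s 6 (∨-falseˡ _ g₃)) 6≡) (trans (regs≡ s 7 (∨-falseˡ _ g₄)) 7≡)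
      (trans 3∉ a≡) (trans 4∉ b≡)

  fetch : State → State
  fetch σ = setReg 7 (arrs σ 3 (regs σ 3)) (setReg 6 (arrs σ 4 (regs σ 3)) σ)

  fetch-fetched : ∀ {P r j p σ} → At P r σ → Slot r j p σ → Fetched P r j p σ (fetch σ)
  fetch-fetched {σ = σ} (at E H 3≡ 8≡) (j≡ , p≡) = fetched
    (at (env-setReg 7 _ refl (env-setReg 6 _ refl E)) (holds (load≡ H) (occ≡ H)) 3≡ 8≡) (j≡ , p≡)
    (trans (cong (arrs σ 4) 3≡) p≡) (trans (cong (arrs σ 3) 3≡) j≡) refl refl

  child-view : ∀ P j p → (Valid P p × nbr j p ≢ 0 × children P j p ≡ 1) ⊎
                         ((Valid P p → nbr j p ≡ 0) × children P j p ≡ 0)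
  child-view P j p = view (defect P p) (nbr j p)
    where
    view : ∀ x y → (x ≡ 0 × y ≢ 0 × child x y ≡ 1) ⊎ ((x ≡ 0 → y ≡ 0) × child x y ≡ 0)
    view zero    zero    = inj₂ ((λ _ → refl) , refl)
    view zero    (suc y) = inj₁ (refl , (λ ()) , refl)
    view (suc x) y       = inj₂ ((λ ()) , refl)

  next-spec : ∀ {P r j p σ τ} → Fetched P r j p σ τ →
    Run next τ 5 (λ υ → At P r υ × Slot r j (suc p) υ × Above r σ υ)
  next-spec {τ = τ} (fetched (at E H 3≡ 8≡) (j≡ , _) 6≡ _ a≡ b≡) = arr-rule
    ( at (env (n≡ E) (m≡ E) (k≡ E) (inc≡ E) (base≡ E)) (holds (load≡ H) (occ≡ H)) 3≡ 8≡
    , (j≡ , trans ([↦]-≡ (arrs τ 4) 3≡) (trans (+-comm _ 1) (cong suc 6≡)))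
    , above λ {x} r<x → cong (λ f → f x) a≡
                , trans ([↦]-≢ (arrs τ 4) (λ e → <⇒≢ r<x (trans (sym 3≡) e))) (cong (λ f → f x) b≡))

  -- With one continuation per outcome, a caller that knows the status of the candidate refutes the
  -- other continuation, and the two kinds of step share this run through `body`.
  examine : ∀ {P r j p σ S Q} → At P r σ → Slot r j p σ → p < m → 5 ≤ S →
    (∀ {τ} → Valid P p → nbr j p ≢ 0 → Fetched P r j p σ τ → Run (push ⨾ enter) τ S Q) →
    (∀ {τ} → (Valid P p → nbr j p ≡ 0) → Fetched P r j p σ τ → Run next τ 5 Q) →
    Run body σ (n * 104 + S) Q
  examine {P} {r} {j} {p} {σ} {S} {Q} A s p<m 5≤S child other = weaken bound≤
    (reg-seq (reg-seq (then-rule in-range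
      (test-spec (environment (current F)) (loads (current F)) (set≡ F) p<m then λ s₁ 5≡ →
        decide 5≡ (fetched-same refl refl refl s₁ F) (defect P p ≟ 0)))))
    where
    F : Fetched P r j p σ (fetch σ)
    F = fetch-fetched A s
    in-range : regs σ 1 ∸ regs (fetch σ) 6 ≢ 0
    in-range e = <⇒≱ p<m (subst₂ _≤_ (m≡ (environment A)) (set≡ F) (m∸n≡0⇒m≤n e))
    decide′ : ∀ {τ} → regs τ 5 ≡ nbr j p → Fetched P r j p σ τ → Valid P p → Dec (nbr j p ≡ 0) →
      Run (if (reg 5) (push ⨾ enter) next) τ (2 + S) Q
    decide′ 5≡ F₂ v (yes e) = weaken (+-monoʳ-≤ 2 5≤S) (else-rule (trans 5≡ e) (other (λ _ → e) F₂))
    decide′ 5≡ F₂ v (no ¬e) = then-rule (λ e → ¬e (trans (sym 5≡) e)) (child v ¬e F₂)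
    decide : ∀ {τ} → regs τ 5 ≡ defect P p → Fetched P r j p σ τ → Dec (Valid P p) →
      Run (if (reg 5) next (neighbour ⨾ if (reg 5) (push ⨾ enter) next)) τ (2 + (n * 50 + (2 + S))) Q
    decide 5≡ F₁ (no ¬v) = weaken (+-monoʳ-≤ 2 (≤-trans 5≤S (≤-trans (m≤n+m S 2) (m≤n+m (2 + S) (n * 50)))))
      (then-rule (λ e → ¬v (trans (sym 5≡) e)) (other (λ v → contradiction v ¬v) F₁))
    decide 5≡ F₁ (yes v) = else-rule (trans 5≡ v)
      (neighbour-spec (environment (current F₁)) (set≡ F₁) (pivot≡ F₁) then λ s₂ 5≡′ →
        decide′ 5≡′ (fetched-same refl refl refl s₂ F₁) v (nbr j p ≟ 0))
    shuffle : ∀ n S → 10 + (n * 40 + (2 + (n * 50 + (2 + S)))) ≡ (14 + n * 90) + S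
    shuffle = solve-∀
    bound≤ : 10 + (n * 40 + (2 + (n * 50 + (2 + S)))) ≤ n * 104 + S
    bound≤ = ≤-trans (≤-reflexive (shuffle n S)) (+-monoˡ-≤ S (linear 14 90))

  skip-child : ∀ {P r j p σ} → At P r σ → Slot r j p σ → p < m → (Valid P p → nbr j p ≡ 0) →
    Run body σ (n * 104 + 5) (λ τ → At P r τ × Slot r j (suc p) τ × Above r σ τ)
  skip-child A s p<m ¬child = examine A s p<m ≤-refl
    (λ v nb _ → contradiction (¬child v) nb) (λ _ → next-spec)

  take-child : ∀ {P r j p σ S Q} → At P (suc r) σ → Slot (suc r) j p σ → p < m → Valid P p → nbr j p ≢ 0 →
    (∀ {τ} → At (p ∷ P) r τ → Slot (suc r) j p τ → Above (suc r) σ τ → Run enter τ S Q) →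
    Run body σ (n * 104 + (n * 33 + S)) Q
  take-child {P} {r} {j} {p} {σ} {S} {Q} A s p<m v nb go = examine A s p<m
    (≤-trans (≤-trans (m≤m+n 5 (n * 0)) (linear 5 0)) (m≤m+n (n * 33) S))
    (λ _ _ F → push-spec (environment (current F)) (loads (current F)) (set≡ F) p<m (valid-fresh {P} v)
                 (remaining (current F)) then pushed F)
    (λ ¬child _ → contradiction (¬child v) nb)
    where
    pushed : ∀ {τ υ} → Fetched P (suc r) j p σ τ → Same push τ υ →
      Holds (p ∷ P) υ × regs υ 3 ≡ r → Run enter υ S Q
    pushed {τ} {υ} F s′ (H , 3≡) = go
      (at (env-same refl s′ (environment (current F))) H 3≡ (trans (regs≡ s′ 8 refl) (running (current F))))
      (trans (cong (λ f → f (suc r)) 3∉) (proj₁ (slot F)) , trans (cong (λ f → f (suc r)) 4∉) (proj₂ (slot F)))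
      (above λ {x} _ → cong (λ f → f x) (trans 3∉ (pivots≡ F)) , cong (λ f → f x) (trans 4∉ (branch≡ F)))
      where
      3∉ : arrs υ 3 ≡ arrs τ 3
      3∉ = arrs≡ s′ 3 refl
      4∉ : arrs υ 4 ≡ arrs τ 4
      4∉ = arrs≡ s′ 4 refl

  finish-level : ∀ {P r j σ S Q} → At P r σ → Slot r j m σ →
    (Fetched P r j m σ (fetch σ) → Run (if (reg 2 ⊖ reg 3) pop (8 ≔ lit 0)) (fetch σ) S Q) →
    Run body σ (10 + S) Q
  finish-level {σ = σ} A s go = reg-seq (reg-seq (else-rule
    (m≤n⇒m∸n≡0 (≤-reflexive (trans (m≡ (environment A)) (sym (set≡ F))))) (go F)))
    where F = fetch-fetched A s

  backtrack : ∀ {P r j j′ p σ} → At (p ∷ P) r σ → Slot r j′ m σ → Slot (suc r) j p σ → r < k → occ p P ≡ 0 →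
    Run body σ (n * 55) (λ τ → At P (suc r) τ × Slot (suc r) j (suc p) τ × Above (suc r) σ τ)
  backtrack {P} {r} {j} {j′} {p} {σ} A s (j≡ , p≡) r<k p∉P = weaken (linear 14 41)
    (finish-level A s λ F → then-rule
      (λ e → <⇒≱ r<k (subst₂ _≤_ (k≡ (environment A)) (remaining A) (m∸n≡0⇒m≤n e)))
      (consequence
        (λ { {τ} s′ (H , 3≡ , 4≡ , unch) →
          at (env-same refl s′ (environment (current F))) H 3≡ (trans (regs≡ s′ 8 refl) (running A))
          , (trans (cong (λ f → f (suc r)) (arrs≡ s′ 3 refl)) j≡ , 4≡)
          , above (unchanged unch) })
        (pop-spec (environment (current F)) (loads (current F)) (remaining A) p≡ p∉P)))

  exhausted : ∀ {P j σ} → At P k σ → Slot k j m σ → Run body σ 16 (λ τ → regs τ 8 ≡ 0 × regs τ 3 ≡ k)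
  exhausted {σ = σ} A s = finish-level A s λ F → else-rule
    (m≤n⇒m∸n≡0 (≤-reflexive (trans (k≡ (environment A)) (sym (remaining A)))))
    (reg-rule (refl , remaining A))

  -- Analysis of the search

  module Scan (B : ℕ) (children≤B : ∀ {P j} → Pivot P j → Σ< m (children P j) ≤ B) where

    enterTime skipTime : ℕ
    enterTime = m * (n * 100)
    skipTime  = n * 111

    -- A level tests all `m` candidates but descends into at most `B` of them. The base value 2 pays
    -- for the last evaluation of the loop guard after success at a leaf.
    levelTime visitTime : ℕ → ℕ
    levelTime zero    = 2
    levelTime (suc r) = m * skipTime + B * visitTime r
    visitTime r = 2 + (n * 104 + (n * 33 + enterTime)) + (levelTime r + (2 + n * 55))

    -- Charging by the actual children still ahead, instead of `B`, makes the cost additive along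
    -- the scan; `B` is used only for a whole level.
    scanTime : List ℕ → ℕ → ℕ → ℕ → ℕ → ℕ
    scanTime P r j p q = q * skipTime + Σ-from p q (children P j) * visitTime r

    scanTime≤ : ∀ P r {j} → Pivot P j → scanTime P r j 0 m ≤ levelTime (suc r)
    scanTime≤ P r {j} piv = +-monoʳ-≤ (m * skipTime) (*-monoˡ-≤ (visitTime r)
      (≤-trans (≤-reflexive (Σ<-split 0 m (children P j))) (children≤B {P} piv)))

    -- Success clears the flag and halts the loop, hence a complete `Run`; failure resumes at the
    -- parent, hence `Steps`.
    Found : List ℕ → ℕ → ℕ → State → Set
    Found P r S σ = Extension P r × Run loop σ S (λ τ → regs τ 3 ≡ 0)

    NoChild : List ℕ → ℕ → ℕ → ℕ → Set
    NoChild P r j p = ∀ {x} → p ≤ x → x < m → Valid P x → nbr j x ≢ 0 → ¬ Extension (x ∷ P) r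

    Scanned : List ℕ → ℕ → ℕ → ℕ → State → State → Set
    Scanned P r j p σ τ = At P (suc r) τ × Slot (suc r) j m τ × Above (suc r) σ τ × NoChild P r j p

    Visited : List ℕ → ℕ → ℕ → ℕ → State → State → Set
    Visited P r j p σ τ =
      At P (suc r) τ × Slot (suc r) j (suc p) τ × Above (suc r) σ τ × (Valid P p → nbr j p ≢ 0 → ¬ Extension (p ∷ P) r)

    Descended : List ℕ → ℕ → ℕ → ℕ → State → State → Set
    Descended P r j p σ τ = ∃[ j′ ] Pivot (p ∷ P) j′ × At (p ∷ P) (suc r) τ × Slot (suc r) j′ 0 τ ×
      Slot (suc (suc r)) j p τ × Above (suc (suc r)) σ τ

    scan-step : ∀ {P r j p σ S S′} → p < m →
      Found P (suc r) S σ ⊎ Steps σ S (Visited P r j p σ) →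
      (∀ {τ} → At P (suc r) τ → Slot (suc r) j (suc p) τ →
        Found P (suc r) S′ τ ⊎ Steps τ S′ (Scanned P r j (suc p) τ)) →
      Found P (suc r) (S + S′) σ ⊎ Steps σ (S + S′) (Scanned P r j p σ)
    scan-step p<m (inj₁ (E , run)) _ = inj₁ (E , weaken (m≤m+n _ _) run)
    scan-step {P} {r} {j} {p} {σ} {S} {S′} p<m (inj₂ s@(steps _ _ (A , sl , ab , ¬p))) go = join (go A sl)
      where
      none′ : NoChild P r j (suc p) → NoChild P r j p
      none′ none p≤x x<m with m≤n⇒m<n∨m≡n p≤x
      ... | inj₁ p<x  = none p<x x<m
      ... | inj₂ refl = ¬p
      join : Found P (suc r) S′ (Steps.end s) ⊎ Steps (Steps.end s) S′ (Scanned P r j (suc p) (Steps.end s)) →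
        Found P (suc r) (S + S′) σ ⊎ Steps σ (S + S′) (Scanned P r j p σ)
      join (inj₁ (E , run)) = inj₁ (E , (s finally run))
      join (inj₂ s′) = inj₂ (weakenSteps ≤-refl
        (λ (A , sl , ab′ , none) → A , sl , above-trans ab ab′ , none′ none) (s andThen s′))

    weakenOutcome : ∀ {P r S S′ σ Q} → S ≤ S′ → Found P r S σ ⊎ Steps σ S Q → Found P r S′ σ ⊎ Steps σ S′ Q
    weakenOutcome h (inj₁ (E , run)) = inj₁ (E , weaken h run)
    weakenOutcome h (inj₂ s) = inj₂ (weakenSteps h (λ q → q) s)

    descend : ∀ {P r j p σ} → At P (suc (suc r)) σ → Slot (suc (suc r)) j p σ → p < m → Valid P p → nbr j p ≢ 0 →
      Run body σ (n * 104 + (n * 33 + enterTime)) (Descended P r j p σ)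
    descend {P} {r} {j} {p} {σ} A sl p<m v nb = take-child A sl p<m v nb λ {τ} A′ sl′ ab →
      consequence
        (λ { s (j′ , piv , j≡ , p≡ , 8≡ , ab′) →
             j′ , piv
             , at (env-same refl s (environment A′)) (holds-same refl s (loads A′))
                  (trans (regs≡ s 3 refl) (remaining A′)) (trans 8≡ (running A′))
             , (j≡ , p≡) , slot-above ≤-refl ab′ sl′
             , above-trans ab (above-suc ab′) })
        (enter-spec (environment A′) (loads A′) (remaining A′))

    visit-leaf : ∀ {P j p σ} → p < m → Feasible P → At P 1 σ → Slot 1 j p σ → Valid P p → nbr j p ≢ 0 →
      Found P 1 (visitTime 0) σ
    visit-leaf {P} {j} {p} {σ} p<m feas A sl v nb =
      unpick p<m (feasible⇒extension (feasible-∷ {P} v feas)) ,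
      weaken time≤ (stop (iterate (running A) (take-child A sl p<m v nb λ A′ _ _ →
        consequence (λ s 8≡0 → 8≡0 , trans (regs≡ s 3 refl) (remaining A′)) (enter-stop (remaining A′)))))
      where
      stop : ∀ {S} → Steps σ S (λ τ → regs τ 8 ≡ 0 × regs τ 3 ≡ 0) → Run loop σ (S + 2) (λ τ → regs τ 3 ≡ 0)
      stop s@(steps _ _ (8≡0 , 3≡0)) = s finally halt 8≡0 3≡0
      4≤ : 4 ≤ enterTime
      4≤ = ≤-trans (m≤m+n 4 (m * 0)) (linear₂ 4 0 {c = 100} z≤n)
      time≤ : 2 + (n * 104 + (n * 33 + 4)) + 2 ≤ visitTime 0
      time≤ = +-mono-≤ (+-monoʳ-≤ 2 (+-monoʳ-≤ (n * 104) (+-monoʳ-≤ (n * 33) 4≤))) (m≤m+n 2 (2 + n * 55))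

    visit-node : ∀ {P r j p σ S} → suc r < k → p < m → Valid P p →
      Steps σ S (Descended P r j p σ) →
      (∀ {j′ τ} → At (p ∷ P) (suc r) τ → Slot (suc r) j′ 0 τ →
        Found (p ∷ P) (suc r) (scanTime (p ∷ P) r j′ 0 m) τ ⊎
        Steps τ (scanTime (p ∷ P) r j′ 0 m) (Scanned (p ∷ P) r j′ 0 τ)) →
      Found P (suc (suc r)) (S + (levelTime (suc r) + (2 + n * 55))) σ ⊎
      Steps σ (S + (levelTime (suc r) + (2 + n * 55))) (Visited P (suc r) j p σ)
    visit-node {P} {r} {j} {p} {σ} {S} r<k p<m v s@(steps _ _ (j′ , piv , A , sl , sl₀ , ab)) go = join (go A sl)
      where
      join : Found (p ∷ P) (suc r) (scanTime (p ∷ P) r j′ 0 m) (Steps.end s) ⊎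
             Steps (Steps.end s) (scanTime (p ∷ P) r j′ 0 m) (Scanned (p ∷ P) r j′ 0 (Steps.end s)) →
        Found P (suc (suc r)) (S + (levelTime (suc r) + (2 + n * 55))) σ ⊎
        Steps σ (S + (levelTime (suc r) + (2 + n * 55))) (Visited P (suc r) j p σ)
      join (inj₁ (E , run)) = inj₁ (unpick p<m E ,
        weaken (+-monoʳ-≤ S (≤-trans (scanTime≤ (p ∷ P) r piv) (m≤m+n _ _))) (s finally run))
      join (inj₂ s′@(steps _ _ (A′ , sl′ , ab′ , none))) = inj₂ (weakenSteps
        (+-monoʳ-≤ S (+-monoˡ-≤ (2 + n * 55) (scanTime≤ (p ∷ P) r piv)))
        (λ (A″ , sl″ , ab″) → A″ , sl″ , above-trans ab (above-trans (above-suc ab′) ab″)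
          -- An extension would, by `branch` at the pivot of the child level, continue with one of
          -- the children that the scan has just excluded.
          , λ _ _ E → let x , x<m , v′ , nb′ , E′ = branch {p ∷ P} piv E in none z≤n x<m v′ nb′ E′)
        (s andThen (s′ andThen iterate (running A′)
          (backtrack A′ sl′ (slot-above ≤-refl ab′ sl₀) r<k (valid-fresh {P} v)))))

    -- The recursion is lexicographic: `scan` decreases the candidates left, and `visit-child`
    -- lowers the number of remaining picks and restarts with all `m` candidates.
    scan : ∀ r q {P j p σ} → suc r ≤ k → p + q ≡ m → Feasible P → At P (suc r) σ → Slot (suc r) j p σ →
      Found P (suc r) (scanTime P r j p q) σ ⊎ Steps σ (scanTime P r j p q) (Scanned P r j p σ)

    visit : ∀ r {P j p σ} → suc r ≤ k → p < m → Feasible P → At P (suc r) σ → Slot (suc r) j p σ →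
      Found P (suc r) (skipTime + children P j p * visitTime r) σ ⊎
      Steps σ (skipTime + children P j p * visitTime r) (Visited P r j p σ)

    visit-child : ∀ r {P j p σ} → suc r ≤ k → p < m → Feasible P → At P (suc r) σ → Slot (suc r) j p σ →
      Valid P p → nbr j p ≢ 0 →
      Found P (suc r) (visitTime r) σ ⊎ Steps σ (visitTime r) (Visited P r j p σ)

    scan r zero {p = p} r<k p+0≡m feas A sl with refl ← trans (sym (+-identityʳ p)) p+0≡m =
      inj₂ (steps (λ y → y) z≤n (A , sl , above-refl , λ p≤x x<m → contradiction p≤x (<⇒≱ x<m)))
    scan r (suc q) {P} {j} {p} r<k p+q≡m feas A sl = weakenOutcome
      (≤-reflexive (shuffle skipTime (q * skipTime) (children P j p) (Σ-from (suc p) q (children P j)) (visitTime r)))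
      (scan-step p<m (visit r r<k p<m feas A sl) (scan r q r<k (trans (sym (+-suc p q)) p+q≡m) feas))
      where
      p<m : p < m
      p<m = subst (p <_) p+q≡m (m<m+n p z<s)
      shuffle : ∀ x qx c s y → (x + c * y) + (qx + s * y) ≡ (x + qx) + (c + s) * y
      shuffle = solve-∀

    visit r {P} {j} {p} r<k p<m feas A sl = decide (child-view P j p)
      where
      decide : (Valid P p × nbr j p ≢ 0 × children P j p ≡ 1) ⊎
               ((Valid P p → nbr j p ≡ 0) × children P j p ≡ 0) → _
      decide (inj₁ (v , nb , c≡1)) = weakenOutcome
        (≤-trans (≤-reflexive (trans (sym (*-identityˡ _)) (cong (_* visitTime r) (sym c≡1)))) (m≤n+m _ skipTime))
        (visit-child r r<k p<m feas A sl v nb)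
      decide (inj₂ (¬child , _)) = inj₂ (weakenSteps
        (≤-trans (≤-trans (≤-reflexive (cong (2 +_) (+-comm (n * 104) 5))) (linear 7 104)) (m≤m+n skipTime _))
        (λ (A , sl , ab) → A , sl , ab , λ v nb → contradiction (¬child v) nb)
        (iterate (running A) (skip-child A sl p<m ¬child)))

    visit-child zero r<k p<m feas A sl v nb = inj₁ (visit-leaf p<m feas A sl v nb)
    visit-child (suc r) {P} r<k p<m feas A sl v nb =
      visit-node r<k p<m v (iterate (running A) (descend A sl p<m v nb))
        (scan r m (<⇒≤ r<k) refl (feasible-∷ {P} v feas))

-- The complete algorithm

dfs greedy overlaps demands rows decide solver : Cmd

dfs = 3 ≔ reg 2 ⨾ 8 ≔ lit 1 ⨾ enter ⨾ loop ⨾ 0 ≔ lit 1 ⊖ reg 3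

greedy =
  9 ≔ lit 0 ⨾
  for 6 1 (test ⨾ 9 ≔ reg 9 ⊕ (lit 1 ⊖ reg 5)) ⨾
  0 ≔ lit 1 ⊖ (reg 2 ⊖ reg 9)

overlaps =
  9 ≔ lit 0 ⨾
  for 6 0 (5 ≔ lit 0 ⨾ sumLoop 1 (missing (reg 4) (reg 6)) ⨾ 9 ≔ reg 9 ⊕ (reg 5 ⊖ lit 1))

demands = 5 ≔ lit 0 ⨾ sumLoop 0 (0 [ reg 4 ] ⊖ reg 2)

rows = for 4 1 (5 [ reg 4 ⊕ lit 1 ]≔ 5 [ reg 4 ] ⊕ reg 0)

-- Past the demand check `k` is positive, as all demands are. So `dfs` can read the answer off
-- register 3, which ends as 0 on success and as `k` on failure.
decide = demands ⨾ if (reg 5) (0 ≔ lit 0) (overlaps ⨾ if (reg 9) dfs greedy)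

solver = rows ⨾ decide

-- The row addresses are multiples of `n`, accumulated by repeated addition starting from the zero
-- already stored in the array.
rows-spec : ∀ σ → (∀ x → arrs σ 5 x ≡ 0) →
  Run rows σ (6 + regs σ 1 * 16) (λ τ → ∀ {j} → j ≤ regs σ 1 → arrs τ 5 j ≡ regs σ 0 * j)
rows-spec σ zeros = for-rule {S = 8} Inv refl refl refl refl
  (λ {i} {τ} i<m 4≡i s inv → arr-rule (extend τ 4≡i s inv))
  λ { z≤n → trans (zeros 0) (sym (*-zeroʳ (regs σ 0))) }
  where
  Inv : ℕ → State → Set
  Inv i τ = ∀ {j} → j ≤ i → arrs τ 5 j ≡ regs σ 0 * j
  extend : ∀ {i} τ → regs τ 4 ≡ i → Same rows σ τ → Inv i τ →
    Inv (suc i) (setArr 5 (regs τ 4 + 1) (arrs τ 5 (regs τ 4) + regs τ 0) τ)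
  extend {i} τ refl s inv {j} j≤1+i with j ≟ suc i
  ... | yes refl = trans ([↦]-≡ (arrs τ 5) (+-comm i 1))
        (trans (cong₂ _+_ (inv ≤-refl) (regs≡ s 0 refl))
               (trans (+-comm (regs σ 0 * i) (regs σ 0)) (sym (*-suc (regs σ 0) i))))
  ... | no j≢1+i = trans ([↦]-≢ (arrs τ 5) (λ e → j≢1+i (trans (sym e) (+-comm i 1))))
        (inv (≤-pred (≤∧≢⇒< j≤1+i j≢1+i)))

-- Specifications of the stages and the time bound

module Decide (n m k : ℕ) (1≤n : 1 ≤ n) (1≤m : 1 ≤ m) (d inc base : ℕ → ℕ)
              (1≤d : ∀ {i} → i < n → 1 ≤ d i) where

  open DepthFirst n m k 1≤n 1≤m d inc base
  open At

  demands-spec : ∀ {σ} → Env σ → Holds [] σ → Run demands σ (n * 24) (λ τ → regs τ 5 ≡ Σ< n (λ i → d i ∸ k))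
  demands-spec {σ} E H = weaken (linear 8 15)
    (reg-seq (sum-rule (λ i → d i ∸ k) (n≡ E) refl refl λ {i} {τ} i<n 4≡i s →
      cong₂ _∸_ (trans (cong₂ (λ f x → f x) (arrs≡ s 0 refl) 4≡i) (load≡ H i<n))
                (trans (regs≡ s 2 refl) (k≡ E))))

  column : ℕ → ℕ
  column i = Σ< m (λ p → miss p i)

  -- The computed sum vanishes exactly when no element lies in two complements, that is, when the
  -- complements are pairwise disjoint.
  overlaps-spec : ∀ {σ} → Env σ → Run overlaps σ (m * (n * 60)) (λ τ → regs τ 9 ≡ Σ< n (λ i → column i ∸ 1))
  overlaps-spec {σ} E = weaken time≤
    (reg-seq (for-rule {S = 8 + m * 18 + 6} (λ i τ → regs τ 9 ≡ Σ< i (λ i → column i ∸ 1)) (n≡ E) refl refl refl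
      (λ {i} {τ} i<n 6≡i s inv → weaken (≤-reflexive (cong (8 +_) (sym (+-assoc 0 (m * 18) 6))))
        (reg-seq
          (sum-rule (λ p → miss p i) (m≡ (E′ s)) refl refl (λ {p} {υ} p<m 4≡p s′ →
             miss-eval (env-same refl s′ (env-setReg 5 0 refl (E′ s))) 4≡p (trans (regs≡ s′ 6 refl) 6≡i))
           then λ {υ} s′ 5≡ → reg-rule {e = reg 9 ⊕ (reg 5 ⊖ lit 1)}
             (cong₂ _+_ (trans (regs≡ s′ 9 refl) inv) (cong (_∸ 1) 5≡)))))
      refl))
    where
    E′ : ∀ {τ} → Same (for 6 0 (5 ≔ lit 0 ⨾ sumLoop 1 (missing (reg 4) (reg 6)) ⨾ 9 ≔ reg 9 ⊕ (reg 5 ⊖ lit 1))) (setReg 9 0 σ) τ → Env τ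
    E′ s = env-same refl s (env-setReg 9 0 refl E)
    shuffle : ∀ n m → 8 + n * (8 + (8 + m * 18 + 6)) ≡ (8 + n * 22) + m * (n * 18)
    shuffle = solve-∀
    time≤ : 8 + n * (8 + (8 + m * 18 + 6)) ≤ m * (n * 60)
    time≤ = begin
      8 + n * (8 + (8 + m * 18 + 6))      ≡⟨ shuffle n m ⟩
      (8 + n * 22) + m * (n * 18)         ≤⟨ +-monoˡ-≤ _ (≤-trans (linear 8 22) (m≤n*m (n * 30) m {{>-nonZero 1≤m}})) ⟩
      m * (n * 30) + m * (n * 18)         ≡⟨ sym (*-distribˡ-+ m (n * 30) (n * 18)) ⟩
      m * (n * 30 + n * 18)               ≡⟨ cong (m *_) (sym (*-distribˡ-+ n 30 18)) ⟩
      m * (n * 48)                        ≤⟨ *-monoʳ-≤ m (*-monoʳ-≤ n (≤ᵇ⇒≤ 48 60 _)) ⟩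
      m * (n * 60)                        ∎
      where open ≤-Reasoning

  greedy-spec : ∀ {σ} → Env σ → Holds [] σ → Run greedy σ (m * (n * 100)) (λ τ → regs τ 0 ≡ 1 ∸ (k ∸ valid-count))
  greedy-spec {σ} E H = weaken time≤
    (reg-seq (for-rule {S = n * 40 + 6} (λ i τ → regs τ 9 ≡ Σ< i (λ p → 1 ∸ defect [] p)) (m≡ E) refl refl refl
      (λ {i} {τ} i<m 6≡i s inv →
        test-spec {P = []} (env-same refl s (env-setReg 9 0 refl E)) (holds-same refl s (holds (load≡ H) (occ≡ H))) 6≡i i<m
        then λ s′ 5≡ → reg-rule {e = reg 9 ⊕ (lit 1 ⊖ reg 5)}
          (cong₂ _+_ (trans (regs≡ s′ 9 refl) inv) (cong (1 ∸_) 5≡)))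
      refl
    then λ s 9≡ → reg-rule (cong (1 ∸_) (cong₂ _∸_ (trans (regs≡ s 2 refl) (k≡ E)) 9≡))))
    where
    shuffle : ∀ n m → 2 + (6 + m * (8 + (n * 40 + 6)) + 6) ≡ 14 + m * (14 + n * 40)
    shuffle = solve-∀
    time≤ : 2 + (6 + m * (8 + (n * 40 + 6)) + 6) ≤ m * (n * 100)
    time≤ = ≤-trans (≤-reflexive (shuffle n m)) (linear₂ 14 54 (linear 14 40))

  extension⇒demand≤ : Extension [] k → ∀ {i} → i < n → d i ≤ k
  extension⇒demand≤ E i<n = ≤-trans (m≤n+m _ _) (Extension.fits E i<n)

  module Bound (a b : ℕ) (row : ∀ {j} → j < m → Σ< n (miss j) ≤ a) (col : ∀ {i} → i < n → column i ≤ b) where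

    B : ℕ
    B = 1 ⊔ (a * b)

    open Scan B (λ {P} → children≤ row col (m≤m⊔n 1 (a * b)) (m≤n⊔m 1 (a * b)) {P})

    size : ℕ → ℕ
    size c = m * (n * c)

    level-step : ∀ {B D T P} → 2 ≤ B → T + 3 * D ≤ 4 * D * P → (D + B * (T + D)) + 3 * D ≤ 4 * D * (B * P)
    level-step {B} {D} {T} {P} 2≤B h = begin
      (D + B * (T + D)) + 3 * D     ≡⟨ shuffle₁ (B * (T + D)) D ⟩
      2 * (2 * D) + B * (T + D)     ≤⟨ +-monoˡ-≤ _ (*-monoˡ-≤ (2 * D) 2≤B) ⟩
      B * (2 * D) + B * (T + D)     ≡⟨ shuffle₂ B D T ⟩
      B * (T + 3 * D)               ≤⟨ *-monoʳ-≤ B h ⟩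
      B * (4 * D * P)               ≡⟨ shuffle₃ B D P ⟩
      4 * D * (B * P)               ∎
      where
      open ≤-Reasoning
      shuffle₁ : ∀ x D → (D + x) + 3 * D ≡ 2 * (2 * D) + x
      shuffle₁ = solve-∀
      shuffle₂ : ∀ B D T → B * (2 * D) + B * (T + D) ≡ B * (T + 3 * D)
      shuffle₂ = solve-∀
      shuffle₃ : ∀ B D P → B * (4 * D * P) ≡ 4 * D * (B * P)
      shuffle₃ = solve-∀

    -- `size 300` is the overhead D of the recurrence: it covers a visit apart from the level below
    -- it, and also all skips on one level.
    visitTime≤ : ∀ r → visitTime r ≤ levelTime r + size 300
    visitTime≤ r = begin
      2 + (n * 104 + (n * 33 + enterTime)) + (levelTime r + (2 + n * 55))  ≡⟨ shuffle n enterTime (levelTime r) ⟩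
      levelTime r + ((4 + n * 192) + enterTime)       ≤⟨ +-monoʳ-≤ (levelTime r) (+-monoˡ-≤ enterTime (≤-trans (linear 4 192) (m≤n*m (n * 196) m {{>-nonZero 1≤m}}))) ⟩
      levelTime r + (size 196 + size 100)             ≡⟨ cong (levelTime r +_) (trans (sym (*-distribˡ-+ m (n * 196) (n * 100))) (cong (m *_) (sym (*-distribˡ-+ n 196 100)))) ⟩
      levelTime r + size 296                          ≤⟨ +-monoʳ-≤ (levelTime r) (*-monoʳ-≤ m (*-monoʳ-≤ n (≤ᵇ⇒≤ 296 300 _))) ⟩
      levelTime r + size 300                          ∎
      where
      open ≤-Reasoning
      shuffle : ∀ n e l → 2 + (n * 104 + (n * 33 + e)) + (l + (2 + n * 55)) ≡ l + ((4 + n * 192) + e)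
      shuffle = solve-∀

    -- The summand 3 * size 300 makes the bound inductive: a level costs
    -- T (1 + r) = D + B (T r + D), and 4 D ≤ B (2 D).
    levelTime≤ : 2 ≤ B → ∀ r → levelTime r + 3 * size 300 ≤ 4 * size 300 * B ^ r
    levelTime≤ 2≤B zero = ≤-trans (+-monoˡ-≤ (3 * size 300) (≤-trans (m≤m+n 2 (m * 0)) (linear₂ 2 0 {c = 300} z≤n)))
                              (≤-reflexive (sym (*-identityʳ (4 * size 300))))
    levelTime≤ 2≤B (suc r) = ≤-trans
      (+-monoˡ-≤ (3 * size 300) (+-mono-≤ (*-monoʳ-≤ m (*-monoʳ-≤ n (≤ᵇ⇒≤ 111 300 _))) (*-monoʳ-≤ B (visitTime≤ r))))
      (level-step {B} {size 300} 2≤B (levelTime≤ 2≤B r))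

    loop-spec : ∀ {r j τ} → k ≡ suc r → Feasible [] → Pivot [] j → At [] k τ → Slot k j 0 τ →
      Run loop τ (levelTime k + 20) (λ υ → Extension [] k × regs υ 3 ≡ 0 ⊎ ¬ Extension [] k × regs υ 3 ≡ k)
    loop-spec {r} {j} {τ} refl feas piv A sl = weaken (+-monoˡ-≤ 20 (scanTime≤ [] r piv)) (join (scan r m ≤-refl refl feas A sl))
      where
      join : Found [] k (scanTime [] r j 0 m) τ ⊎ Steps τ (scanTime [] r j 0 m) (Scanned [] r j 0 τ) →
        Run loop τ (scanTime [] r j 0 m + 20) (λ υ → Extension [] k × regs υ 3 ≡ 0 ⊎ ¬ Extension [] k × regs υ 3 ≡ k)
      join (inj₁ (E , run)) = weaken (m≤m+n _ 20) (consequence (λ _ 3≡0 → inj₁ (E , 3≡0)) run)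
      join (inj₂ s@(steps _ _ (A′ , sl′ , _ , none))) = weaken (≤-reflexive (+-assoc _ 18 2))
        (finish (s andThen iterate (running A′) (exhausted A′ sl′)))
        where
        ¬E : ¬ Extension [] k
        ¬E E = let x , x<m , v , nb , E′ = branch {[]} piv E in none z≤n x<m v nb E′
        finish : ∀ {S} → Steps τ S (λ υ → regs υ 8 ≡ 0 × regs υ 3 ≡ k) →
          Run loop τ (S + 2) (λ υ → Extension [] k × regs υ 3 ≡ 0 ⊎ ¬ Extension [] k × regs υ 3 ≡ k)
        finish s@(steps _ _ (8≡0 , 3≡k)) = s finally halt 8≡0 (inj₂ (¬E , 3≡k))

    dfs-spec : ∀ {r σ} → k ≡ suc r → 2 ≤ B → Feasible [] → Env σ → Holds [] σ →
      Run dfs σ (size 1200 * B ^ k) (Answers (Extension [] k))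
    dfs-spec {r} {σ} k≡1+r 2≤B feas E H = weaken time≤
      (reg-seq (reg-seq (enter-spec E₁ H₁ (trans (k≡ E) k≡1+r) then λ { {τ} s (j , piv , j≡ , p≡ , 8≡ , _) →
        loop-spec k≡1+r feas piv
          (at (env-same refl s E₁) (holds-same refl s H₁) (trans (regs≡ s 3 refl) (k≡ E)) 8≡)
          (subst (λ x → Slot x j 0 τ) (sym k≡1+r) (j≡ , p≡))
        then λ _ → λ { (inj₁ (X , 3≡0)) → reg-rule (inj₁ (X , cong (1 ∸_) 3≡0))
                     ; (inj₂ (¬X , 3≡k)) → reg-rule (inj₂ (¬X , trans (cong (1 ∸_) (trans 3≡k k≡1+r)) (0∸n≡0 r))) } })))
      where
      σ₁ = setReg 8 1 (setReg 3 (regs σ 2) σ)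
      E₁ : Env σ₁
      E₁ = env-setReg 8 1 refl (env-setReg 3 _ refl E)
      H₁ : Holds [] σ₁
      H₁ = holds (load≡ H) (occ≡ H)
      shuffle : ∀ e l → 4 + (e + ((l + 20) + 4)) ≡ l + (28 + e)
      shuffle = solve-∀
      time≤ : 4 + (enterTime + ((levelTime k + 20) + 4)) ≤ size 1200 * B ^ k
      time≤ = begin
        4 + (enterTime + ((levelTime k + 20) + 4))  ≡⟨ shuffle enterTime (levelTime k) ⟩
        levelTime k + (28 + enterTime)              ≤⟨ +-monoʳ-≤ (levelTime k) (linear₂ 28 100 {c = 300} ≤-refl) ⟩
        levelTime k + size 300                      ≤⟨ +-monoʳ-≤ (levelTime k) (m≤n*m (size 300) 3) ⟩
        levelTime k + 3 * size 300                  ≤⟨ levelTime≤ 2≤B k ⟩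
        4 * size 300 * B ^ k                        ≡⟨ cong (_* B ^ k) (shuffle′ m n) ⟩
        size 1200 * B ^ k                           ∎
        where
        open ≤-Reasoning
        shuffle′ : ∀ m n → 4 * (m * (n * 300)) ≡ m * (n * 1200)
        shuffle′ = solve-∀

    -- An element in two complements gives `b` at least 2, and either of these complements, being
    -- nonempty, gives `a` at least 1.
    2≤product : ∀ {i} → i < n → column i ∸ 1 ≢ 0 → 2 ≤ a * b
    2≤product {i} i<n h = *-mono-≤ 1≤a 2≤b
      where
      2≤column : 2 ≤ column i
      2≤column = ≰⇒> λ c≤1 → h (m≤n⇒m∸n≡0 c≤1)
      2≤b : 2 ≤ b
      2≤b = ≤-trans 2≤column (col i<n)
      1≤a : 1 ≤ a
      1≤a = let p , p<m , miss≢0 = Σ<≢0⇒term m (λ p → miss p i) (λ e → <⇒≱ 2≤column (≤-trans (≤-reflexive e) z≤n)) in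
        ≤-trans (n≢0⇒n>0 miss≢0) (≤-trans (term≤Σ< n (miss p) i<n) (row p<m))

    instance
      B≢0 : NonZero B
      B≢0 = >-nonZero (m≤m⊔n 1 (a * b))

    decide-spec : ∀ {σ} → Env σ → Holds [] σ → Run decide σ (size 1300 * B ^ k) (Answers (Extension [] k))
    decide-spec {σ} E H = weaken time≤
      (demands-spec E H then λ s 5≡ → on-demands (env-same refl s E) (holds-same refl s H) 5≡ (Σ< n (λ i → d i ∸ k) ≟ 0))
      where
      Goal : State → Set
      Goal = Answers (Extension [] k)

      dfsTime : ℕ
      dfsTime = size 1200 * B ^ k

      small : ∀ c → {_ : True (c ≤? 1200)} → size c ≤ dfsTime
      small c {h} = ≤-trans (*-monoʳ-≤ m (*-monoʳ-≤ n (toWitness h))) (m≤m*n (size 1200) (B ^ k) {{m^n≢0 B k}})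

      on-overlap : ∀ {τ} → Env τ → Holds [] τ → (∀ {i} → i < n → d i ≤ k) →
        regs τ 9 ≡ Σ< n (λ i → column i ∸ 1) → Dec (Σ< n (λ i → column i ∸ 1) ≡ 0) →
        Run (if (reg 9) dfs greedy) τ (2 + dfsTime) Goal
      on-overlap {τ} E H d≤k 9≡ (yes e) = else-rule (trans 9≡ e)
        (weaken (small 100) (consequence (λ {υ} _ → judge {υ} (k ≤? valid-count)) (greedy-spec E H)))
        where
        column≤1 : ∀ {i} → i < n → column i ≤ 1
        column≤1 i<n = m∸n≡0⇒m≤n (n≤0⇒n≡0 (≤-trans (term≤Σ< n _ i<n) (≤-reflexive e)))
        judge : ∀ {υ} → Dec (k ≤ valid-count) → regs υ 0 ≡ 1 ∸ (k ∸ valid-count) → Goal υ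
        judge (yes h) 0≡ = inj₁ (valid-count⇒extension column≤1 d≤k h , trans 0≡ (cong (1 ∸_) (m≤n⇒m∸n≡0 h)))
        judge (no ¬h) 0≡ = inj₂ ((λ X → ¬h (extension⇒valid-count X)) ,
          trans 0≡ (m≤n⇒m∸n≡0 (m<n⇒0<n∸m (≰⇒> ¬h))))
      on-overlap {τ} E H d≤k 9≡ (no ¬e) = then-rule (λ e → ¬e (trans (sym 9≡) e))
        -- Element 0 exists and has a positive demand of at most `k`, so `k` is a successor.
        (dfs-spec {pred k} (sym (suc-pred k {{>-nonZero (≤-trans (1≤d 1≤n) (d≤k 1≤n))}}))
          (≤-trans (2≤product (proj₁ (proj₂ witness)) (proj₂ (proj₂ witness))) (m≤n⊔m 1 (a * b)))
          ((λ _ → z≤n) , d≤k) E H)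
        where witness = Σ<≢0⇒term n (λ i → column i ∸ 1) ¬e

      on-demands : ∀ {τ} → Env τ → Holds [] τ → regs τ 5 ≡ Σ< n (λ i → d i ∸ k) → Dec (Σ< n (λ i → d i ∸ k) ≡ 0) →
        Run (if (reg 5) (0 ≔ lit 0) (overlaps ⨾ if (reg 9) dfs greedy)) τ (2 + (m * (n * 60) + (2 + dfsTime))) Goal
      on-demands E H 5≡ (yes e) = else-rule (trans 5≡ e)
        (overlaps-spec E then λ s 9≡ → on-overlap (env-same refl s E) (holds-same refl s H)
          (λ i<n → m∸n≡0⇒m≤n (n≤0⇒n≡0 (≤-trans (term≤Σ< n _ i<n) (≤-reflexive e)))) 9≡ (Σ< n (λ i → column i ∸ 1) ≟ 0))
      on-demands E H 5≡ (no ¬e) = weaken (+-monoʳ-≤ 2 (≤-trans (m≤m+n 2 dfsTime) (m≤n+m (2 + dfsTime) (m * (n * 60)))))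
        (then-rule (λ e → ¬e (trans (sym 5≡) e)) (reg-rule (inj₂ (impossible , refl))))
        where
        impossible : ¬ Extension [] k
        impossible X = let i , i<n , excess = Σ<≢0⇒term n (λ i → d i ∸ k) ¬e in
          excess (m≤n⇒m∸n≡0 (extension⇒demand≤ X i<n))

      shuffle : ∀ x y t → x + (2 + (y + (2 + t))) ≡ (4 + x) + y + t
      shuffle = solve-∀
      time≤ : n * 24 + (2 + (m * (n * 60) + (2 + dfsTime))) ≤ size 1300 * B ^ k
      time≤ = begin
        n * 24 + (2 + (m * (n * 60) + (2 + dfsTime)))  ≡⟨ shuffle (n * 24) (size 60) dfsTime ⟩
        (4 + n * 24) + size 60 + dfsTime               ≤⟨ +-monoˡ-≤ dfsTime (+-monoˡ-≤ (size 60) (≤-trans (linear 4 24) (m≤n*m (n * 40) m {{>-nonZero 1≤m}}))) ⟩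
        size 40 + size 60 + dfsTime                    ≡⟨ cong (_+ dfsTime) (shuffle′ m n) ⟩
        size 100 + dfsTime                             ≤⟨ +-monoˡ-≤ dfsTime (m≤m*n (size 100) (B ^ k) {{m^n≢0 B k}}) ⟩
        size 100 * B ^ k + size 1200 * B ^ k     ≡⟨ sym (*-distribʳ-+ (B ^ k) (size 100) (size 1200)) ⟩
        (size 100 + size 1200) * B ^ k           ≡⟨ cong (_* B ^ k) (shuffle″ m n) ⟩
        size 1300 * B ^ k                        ∎
        where
        open ≤-Reasoning
        shuffle′ : ∀ m n → m * (n * 40) + m * (n * 60) ≡ m * (n * 100)
        shuffle′ = solve-∀
        shuffle″ : ∀ m n → m * (n * 100) + m * (n * 1200) ≡ m * (n * 1300)
        shuffle″ = solve-∀

-- Instances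

minimum≤ : ∀ {p} .{{_ : NonZero p}} (f : Fin p → ℕ) i → minimum f ≤ f i
minimum≤ {suc zero}    f zero    = ≤-refl
minimum≤ {suc (suc p)} f zero    = m⊓n≤m (f zero) _
minimum≤ {suc (suc p)} f (suc i) = ≤-trans (m⊓n≤n (f zero) _) (minimum≤ (λ j → f (suc j)) i)

layout-toℕ : ∀ {p} (f : Fin p → ℕ) i → layout f (toℕ i) ≡ f i
layout-toℕ f zero    = refl
layout-toℕ f (suc i) = layout-toℕ (λ j → f (suc j)) i

bit : Bool → ℕ
bit b = if b then 1 else 0

bit-∧ : ∀ b c → bit (b ∧ c) ≡ bit b * bit c
bit-∧ false c = refl
bit-∧ true  c = sym (+-identityʳ (bit c))

bit-not : ∀ b → bit (not b) ≡ 1 ∸ bit b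
bit-not false = refl
bit-not true  = refl

bit-0<ᵇ : ∀ {x} → x ≤ 1 → bit (0 <ᵇ x) ≡ x
bit-0<ᵇ z≤n       = refl
bit-0<ᵇ (s≤s z≤n) = refl

Σ<-card : ∀ {p} (S : Subset p) (f : ℕ → ℕ) → (∀ i → f (toℕ i) ≡ bit (lookup S i)) → Σ< p f ≡ ∣ S ∣
Σ<-card []                    f h = refl
Σ<-card {suc p} (false ∷ S) f h = trans (Σ<-suc p f)
  (cong₂ _+_ (h zero) (Σ<-card S (f ∘ suc) (h ∘ suc)))
Σ<-card {suc p} (true ∷ S)  f h = trans (Σ<-suc p f)
  (cong₂ _+_ (h zero) (Σ<-card S (f ∘ suc) (h ∘ suc)))

<⇒Fin : ∀ {p} (P : ℕ → Set) → (∀ (i : Fin p) → P (toℕ i)) → ∀ {j} → j < p → P j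
<⇒Fin P h j<p = subst P (toℕ-fromℕ< j<p) (h (fromℕ< j<p))

-- Equating multiplicities with bits makes the list a duplicate-free enumeration of the subset.
record Lists {p} (Q : List ℕ) (S : Subset p) : Set where
  constructor lists
  field
    below : All (_< p) Q
    count : ∀ j → occ (toℕ j) Q ≡ bit (lookup S j)

occ-0-suc : ∀ Q → occ 0 (map suc Q) ≡ 0
occ-0-suc []      = refl
occ-0-suc (q ∷ Q) = occ-0-suc Q

occ-suc-suc : ∀ j Q → occ (suc j) (map suc Q) ≡ occ j Q
occ-suc-suc j []      = refl
occ-suc-suc j (q ∷ Q) = cong (δ j q +_) (occ-suc-suc j Q)

members : ∀ {p} (S : Subset p) → Σ[ Q ∈ List ℕ ] Lists Q S
members []          = [] , lists [] λ ()
members (b ∷ S) with Q , lists a c ← members S with b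
... | false = map suc Q , lists (map⁺ (All-map s≤s a))
  λ { zero → occ-0-suc Q ; (suc j) → trans (occ-suc-suc (toℕ j) Q) (c j) }
... | true  = 0 ∷ map suc Q , lists (z<s ∷ map⁺ (All-map s≤s a))
  λ { zero → cong suc (occ-0-suc Q) ; (suc j) → trans (occ-suc-suc (toℕ j) Q) (c j) }

subset : ∀ {p Q} → All (_< p) Q → (∀ j → occ j Q ≤ 1) → Σ[ S ∈ Subset p ] Lists Q S
subset {p} {Q} a f = tabulate chosen , lists a λ j →
  trans (sym (bit-0<ᵇ (f (toℕ j)))) (cong bit (sym (lookup∘tabulate chosen j)))
  where
  chosen : Fin p → Bool
  chosen j = 0 <ᵇ occ (toℕ j) Q

module _ {p Q} {S : Subset p} (L : Lists Q S) where

  open Lists L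

  lists-length : length Q ≡ ∣ S ∣
  lists-length = trans (length≡total Q) (trans (total-by-occ (const 1) Q below)
    (Σ<-card S _ λ i → trans (*-identityʳ _) (count i)))

  lists-occ≤1 : ∀ j → occ j Q ≤ 1
  lists-occ≤1 j with j <? p
  ... | yes j<p = <⇒Fin (λ j → occ j Q ≤ 1) (λ i → subst (_≤ 1) (sym (count i)) (bit≤1 (lookup S i))) j<p
    where
    bit≤1 : ∀ b → bit b ≤ 1
    bit≤1 false = z≤n
    bit≤1 true  = ≤-refl
  ... | no j≮p  = ≤-trans (≤-reflexive (occ-above (All-map (λ q<p → <-≤-trans q<p (≮⇒≥ j≮p)) below))) z≤n

  -- As `g` is the indicator of the complement of `O`, each member of `S` is counted by exactly one
  -- of the two summands.
  lists-outside : ∀ (O : Subset p) g → (∀ j → g (toℕ j) ≡ bit (not (lookup O j))) →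
    total g Q + ∣ S ∩ O ∣ ≡ ∣ S ∣
  lists-outside O g h = begin
    total g Q + ∣ S ∩ O ∣                                              ≡⟨ cong₂ _+_ (total-by-occ g Q below) (sym (Σ<-card (S ∩ O) _ inside)) ⟩
    Σ< p (λ j → occ j Q * g j) + Σ< p (λ j → occ j Q * (1 ∸ g j))      ≡⟨ sym (Σ<-+ p _ _) ⟩
    Σ< p (λ j → occ j Q * g j + occ j Q * (1 ∸ g j))                   ≡⟨ Σ<-card S _ all ⟩
    ∣ S ∣                                                              ∎
    where
    open ≡-Reasoning
    1∸not : ∀ b → 1 ∸ bit (not b) ≡ bit b
    1∸not false = refl
    1∸not true  = refl
    not+ : ∀ b → bit (not b) + bit b ≡ 1
    not+ false = refl
    not+ true  = refl
    1∸g : ∀ j → 1 ∸ g (toℕ j) ≡ bit (lookup O j)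
    1∸g j = trans (cong (1 ∸_) (h j)) (1∸not (lookup O j))
    inside : ∀ j → occ (toℕ j) Q * (1 ∸ g (toℕ j)) ≡ bit (lookup (S ∩ O) j)
    inside j = trans (cong₂ _*_ (count j) (1∸g j)) (trans (sym (bit-∧ (lookup S j) (lookup O j)))
      (cong bit (sym (lookup-zipWith _∧_ j S O))))
    all : ∀ j → occ (toℕ j) Q * g (toℕ j) + occ (toℕ j) Q * (1 ∸ g (toℕ j)) ≡ bit (lookup S j)
    all j = begin
      occ (toℕ j) Q * g (toℕ j) + occ (toℕ j) Q * (1 ∸ g (toℕ j))  ≡⟨ sym (*-distribˡ-+ (occ (toℕ j) Q) (g (toℕ j)) _) ⟩
      occ (toℕ j) Q * (g (toℕ j) + (1 ∸ g (toℕ j)))                ≡⟨ cong₂ _*_ (count j) (trans (cong₂ _+_ (h j) (1∸g j)) (not+ (lookup O j))) ⟩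
      bit (lookup S j) * 1                                         ≡⟨ *-identityʳ _ ⟩
      bit (lookup S j)                                             ∎

-- Covers as packings of complements

module Correct (I : SetCoverInstance) where

  open SetCoverInstance I

  1≤n : 1 ≤ n
  1≤n = >-nonZero⁻¹ n

  1≤m : 1 ≤ m
  1≤m = >-nonZero⁻¹ m

  d inc : ℕ → ℕ
  d   = arrs (encodeSetCover I) 0
  inc = arrs (encodeSetCover I) 1

  inc-combine : ∀ j i → inc (n * toℕ j + toℕ i) ≡ bit (lookup (F j) i)
  inc-combine j i = trans (cong inc (sym (toℕ-combine j i)))
    (trans (layout-toℕ _ (combine j i))
           (cong (λ (j , i) → bit (lookup (F j) i)) (remQuot-combine {n = m} {k = n} j i)))

  1≤d : ∀ {i} → i < n → 1 ≤ d i
  1≤d = <⇒Fin (λ i → 1 ≤ d i) λ i → subst (1 ≤_) (sym (layout-toℕ demand i)) (proj₁ (demand∈[m] i))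

  module WithBase (base : ℕ → ℕ) (rows≡ : ∀ {j} → j ≤ m → base j ≡ n * j) where

    open Search n m k 1≤n 1≤m d inc base

    miss-F : ∀ j i → miss (toℕ j) (toℕ i) ≡ bit (not (lookup (F j) i))
    miss-F j i = trans (cong (1 ∸_) (trans (cong (λ x → inc (x + toℕ i)) (rows≡ (<⇒≤ (toℕ<n j)))) (inc-combine j i)))
      (sym (bit-not (lookup (F j) i)))

    miss-occurrences : ∀ i j → miss (toℕ j) (toℕ i) ≡ bit (not (lookup (occurrences i) j))
    miss-occurrences i j = trans (miss-F j i)
      (cong (bit ∘ not) (sym (lookup∘tabulate (λ j → lookup (F j) i) j)))

    Σ<-∁ : ∀ {p} (O : Subset p) f → (∀ j → f (toℕ j) ≡ bit (not (lookup O j))) → Σ< p f ≡ p ∸ ∣ O ∣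
    Σ<-∁ O f h = trans (Σ<-card (∁ O) f λ j → trans (h j) (cong bit (sym (lookup-map j not O)))) (∣∁p∣≡n∸∣p∣ O)

    row : ∀ {j} → j < m → Σ< n (miss j) ≤ n ∸ s-min
    row = <⇒Fin (λ j → Σ< n (miss j) ≤ n ∸ s-min) λ j → ≤-trans
      (≤-reflexive (Σ<-∁ (F j) _ (miss-F j)))
      (∸-monoʳ-≤ n (minimum≤ (λ j → ∣ F j ∣) j))

    col : ∀ {i} → i < n → Σ< m (λ p → miss p i) ≤ m ∸ o-min
    col = <⇒Fin (λ i → Σ< m (λ p → miss p i) ≤ m ∸ o-min) λ i → ≤-trans
      (≤-reflexive (Σ<-∁ (occurrences i) _ (miss-occurrences i)))
      (∸-monoʳ-≤ m (minimum≤ (λ i → ∣ occurrences i ∣) i))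

    -- Each chosen set either misses `i` or contains it. With `k` chosen sets, this additive
    -- identity trades the demand for a capacity without any subtraction.
    balance : ∀ {Q S} → Lists Q S → ∀ i → total (λ p → miss p (toℕ i)) Q + ∣ S ∩ occurrences i ∣ ≡ ∣ S ∣
    balance L i = lists-outside L (occurrences i) _ (miss-occurrences i)

    coverable⇒extension : Coverable → Extension [] k
    coverable⇒extension (S , ∣S∣≡k , covers) = let Q , L = members S in
      extension Q (Lists.below L) (trans (lists-length L) ∣S∣≡k)
        (λ j → ≤-trans (≤-reflexive (+-identityʳ _)) (lists-occ≤1 L j))
        (<⇒Fin (λ i → total (λ p → miss p i) Q + d i ≤ k) λ i → begin
          total (λ p → miss p (toℕ i)) Q + d (toℕ i)              ≤⟨ +-monoʳ-≤ (total (λ p → miss p (toℕ i)) Q) (≤-trans (≤-reflexive (layout-toℕ demand i)) (covers i)) ⟩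
          total (λ p → miss p (toℕ i)) Q + ∣ S ∩ occurrences i ∣  ≡⟨ balance L i ⟩
          ∣ S ∣                                                   ≡⟨ ∣S∣≡k ⟩
          k                                                       ∎)
      where open ≤-Reasoning

    extension⇒coverable : Extension [] k → Coverable
    extension⇒coverable (extension Q a s f h) =
      let S , L = subset a (λ j → ≤-trans (≤-reflexive (sym (+-identityʳ _))) (f j))
          ∣S∣≡k = trans (sym (lists-length L)) s
      in S , ∣S∣≡k , λ i → +-cancelˡ-≤ (total (λ p → miss p (toℕ i)) Q) _ _ (begin
        total (λ p → miss p (toℕ i)) Q + demand i               ≡⟨ cong (total (λ p → miss p (toℕ i)) Q +_) (sym (layout-toℕ demand i)) ⟩
        total (λ p → miss p (toℕ i)) Q + d (toℕ i)              ≤⟨ h (toℕ<n i) ⟩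
        k                                                       ≡⟨ sym ∣S∣≡k ⟩
        ∣ S ∣                                                   ≡⟨ sym (balance L i) ⟩
        total (λ p → miss p (toℕ i)) Q + ∣ S ∩ occurrences i ∣  ∎)
      where open ≤-Reasoning

  open ≤-Reasoning

  timeBound : ℕ
  timeBound = (n * m) * (1 ⊔ ((n ∸ s-min) * (m ∸ o-min))) ^ k

  answers-map : ∀ {X Y σ} → (X → Y) → (Y → X) → Answers X σ → Answers Y σ
  answers-map f g (inj₁ (x , e))  = inj₁ (f x , e)
  answers-map f g (inj₂ (¬x , e)) = inj₂ (¬x ∘ g , e)

  decide-after-rows : ∀ {τ} → Same rows (encodeSetCover I) τ → (∀ {j} → j ≤ m → arrs τ 5 j ≡ n * j) →
    Run decide τ (m * (n * 1300) * (1 ⊔ ((n ∸ s-min) * (m ∸ o-min))) ^ k) (Answers Coverable)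
  decide-after-rows {τ} s rows≡ = consequence
    (λ {σ} _ → answers-map {σ = σ} extension⇒coverable coverable⇒extension)
    (Decide.Bound.decide-spec n m k 1≤n 1≤m d inc base 1≤d (n ∸ s-min) (m ∸ o-min) row col
      (env (regs≡ s 0 refl) (regs≡ s 1 refl) (regs≡ s 2 refl) (arrs≡ s 1 refl) refl)
      (holds (λ {i} _ → cong (λ f → f i) (arrs≡ s 0 refl)) (λ {j} _ → cong (λ f → f j) (arrs≡ s 2 refl))))
    where
    base : ℕ → ℕ
    base = arrs τ 5
    open WithBase base rows≡
    open Search n m k 1≤n 1≤m d inc base using (env; holds)

  solver-spec : Run solver (encodeSetCover I) (1400 * timeBound) (Answers Coverable)
  solver-spec = weaken time≤ (rows-spec (encodeSetCover I) (λ _ → refl) then decide-after-rows)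
    where
    B : ℕ
    B = 1 ⊔ ((n ∸ s-min) * (m ∸ o-min))
    shuffle : ∀ c n m x → m * (n * c) * x ≡ c * ((n * m) * x)
    shuffle = solve-∀
    1≤Bᵏ : NonZero (B ^ k)
    1≤Bᵏ = m^n≢0 B k {{>-nonZero (m≤m⊔n 1 ((n ∸ s-min) * (m ∸ o-min)))}}
    -- Of the 1400, a share of 100 pays for the row addresses and 1300 for `decide`.
    time≤ : (6 + m * 16) + m * (n * 1300) * B ^ k ≤ 1400 * timeBound
    time≤ = begin
      (6 + m * 16) + m * (n * 1300) * B ^ k          ≤⟨ +-monoˡ-≤ _ (+-mono-≤ (m≤n*m 6 m) (*-monoʳ-≤ m (≤ᵇ⇒≤ 16 94 _))) ⟩
      (m * 6 + m * 94) + m * (n * 1300) * B ^ k      ≡⟨ cong (_+ m * (n * 1300) * B ^ k) (sym (*-distribˡ-+ m 6 94)) ⟩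
      m * 100 + m * (n * 1300) * B ^ k               ≤⟨ +-monoˡ-≤ _ (≤-trans (*-monoʳ-≤ m (m≤n*m 100 n)) (m≤m*n (m * (n * 100)) (B ^ k) {{1≤Bᵏ}})) ⟩
      m * (n * 100) * B ^ k + m * (n * 1300) * B ^ k ≡⟨ cong₂ _+_ (shuffle 100 n m (B ^ k)) (shuffle 1300 n m (B ^ k)) ⟩
      100 * timeBound + 1300 * timeBound                     ≡⟨ sym (*-distribʳ-+ timeBound 100 1300) ⟩
      1400 * timeBound                                   ∎

corollary1 : SolvableInTimeO SetCoverWithDemands
    (λ I → let open SetCoverInstance I in
    (n * m) * (1 ⊔ ((n ∸ s-min) * (m ∸ o-min))) ^ k)
corollary1 = solver , 1400 , λ I →
  let mkRun {σ} {t} x b q = Correct.solver-spec I in σ , t , x , q , b
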